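{- For every integer $n\geq 1$, the polynomial $\tilde A_n(x,y|\alpha)$ has an expansion $$\tilde A_n(x,y|\alpha)=\sum_{k=0}^{\lfloor n/2\rfloor}\tilde{\gamma}_{n,k}(\alpha)\,(xy)^{k}(x+y)^{n-2k},$$ where for each $0\le k\le \lfloor n/2\rfloor$, $$\tilde{\gamma}_{n,k}(\alpha)=\sum_{\sigma \in \Gamma^{(1)}_{n,k}}\alpha^{\mathrm{LRmin}(\sigma)+\mathrm{RLmin}(\sigma)-2} =2^{ -n+2k}\sum_{\sigma \in \Gamma^{(2)}_{n,k}}\alpha^{\mathrm{LRmin}(\sigma)+\mathrm{RLmin}(\sigma)-2} =\sum_{\sigma \in \Gamma^{(3)}_{n,k}}\alpha^{\mathrm{RLmin}(\sigma)}.$$ Here: (1) $\Gamma^{(1)}_{n,k}$ is the set of permutations in $\mathrm{PRW}_{n+1}$ with $k$ ascents and no double ascents; (2) $\Gamma^{(2)}_{n,k}$ is the set of permutations in $\mathrm{PRW}_{n+1}$ with $k$ peaks; (3) $\Gamma^{(3)}_{n,k}$ is the set of permutations $\sigma=\sigma_1\cdots\sigma_n\in\mathfrak{S}_n$ with $k$ descents for which there is no index $1<i<n$ with $\sigma_{i-1}>\sigma_i>\sigma_{i+1}$.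
   Context: $\mathfrak{S}_n$ is the set of permutations $\sigma=\sigma_1\cdots\sigma_n$ of $[n]=\{1,\dots,n\}$. An index $i\in[n-1]$ is a descent (resp. ascent) of $\sigma$ if $\sigma_i>\sigma_{i+1}$ (resp. $\sigma_i<\sigma_{i+1}$); $\mathrm{des}(\sigma)$ and $\mathrm{asc}(\sigma)$ are the numbers of descents and ascents. $\mathrm{PRW}_n$ is the set of $\pi\in\mathfrak{S}_n$ such that the first ascent (if any) of $\pi$ appears at the letter $1$; i.e., if $\pi$ has an ascent and $i$ is the smallest one, then $\pi_i=1$. A left-to-right minimum (resp. right-to-left minimum) of $\sigma\in\mathfrak{S}_n$ is a letter $\sigma_i$ such that $\sigma_j>\sigma_i$ for every $j<i$ (resp. every $j>i$); $\mathrm{LRmin}(\sigma)$ and $\mathrm{RLmin}(\sigma)$ are the numbers of these. With the convention $\sigma_0=\sigma_{n+1}=+\infty$ for $\sigma\in\mathfrak{S}_n$, a value $\sigma_i$ ($1\le i\le n$) is a double ascent if $\sigma_{i-1}<\sigma_i<\sigma_{i+1}$, and a peak if $\sigma_{i-1}<\sigma_i>\sigma_{i+1}$. The binomial-Stirling-Eulerian polynomials are $$\tilde{A}_n(x,y|\alpha)=\sum_{\sigma\in\mathrm{PRW}_{n+1}}x^{\mathrm{des}(\sigma)}y^{\mathrm{asc}(\sigma)}\alpha^{\mathrm{LRmin}(\sigma)+\mathrm{RLmin}(\sigma)-2}.$$ -}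

module Defs where

open import Algebra.Bundles using (RawSemiring)
import Algebra.Definitions.RawSemiring as RawSemiringDefs
open import Data.Fin using (Fin; toℕ; fromℕ; fromℕ<; punchIn)
import Data.Fin.Properties as Fin
open import Data.Fin.Permutation as Perm
  using (Permutation′; _⟨$⟩ʳ_; _⟨$⟩ˡ_; insert; remove; inverseʳ; inverseˡ;
         insert-punchIn; insert-remove)
open import Data.List
  using (List; []; _∷_; _++_; map; foldr; filter; length; applyUpTo; allFin; cartesianProductWith)
open import Data.List.Membership.Propositional.Properties using (∈-allFin)
import Data.List.Membership.Setoid as Membership
import Data.List.Membership.Setoid.Properties as Membershipₚ
open import Data.List.Relation.Unary.All using (All; all?; [])
open import Data.List.Relation.Unary.AllPairs using ([]; _∷_)
open import Data.List.Relation.Unary.Any using (here)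
import Data.List.Relation.Unary.Unique.Setoid as Unique
import Data.List.Relation.Unary.Unique.Setoid.Properties as Uniqueₚ
open import Data.List.Relation.Unary.Unique.Propositional.Properties using (allFin⁺)
open import Data.Nat as ℕ using (ℕ; zero; suc; pred; _∸_)
open import Data.Product using (_×_; _,_)
open import Data.Rational as ℚ using (ℚ; 0ℚ; 1ℚ)
open import Data.Vec as Vec using (Vec; replicate; zipWith; _[_]≔_)
import Data.Vec.Properties as Vec
open import Data.Bool using (if_then_else_)
open import Level using (0ℓ)
open import Relation.Binary.Bundles using (Setoid)
open import Relation.Binary.Construct.Add.Supremum.Strict ℕ._<_ using (_<⁺_; <⁺-dec)
open import Relation.Binary.PropositionalEquality
open import Relation.Nullary using (Dec; yes; no; does; ¬_; contradiction)
open import Relation.Nullary.Construct.Add.Supremum using (_⁺; ⊤⁺; [_]; ≡-dec)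
open import Relation.Nullary.Decidable using (¬?; _→-dec_; _×-dec_)
open import Relation.Unary using (Pred; Decidable)

------------------------------------------------------------------------
-- Polynomials over ℚ in v variables

-- A polynomial is a formal sum of monomials c·X₁^e₁⋯Xᵥ^eᵥ, stored as (c , e).
-- The same exponent vector may occur several times; equality compares the
-- total coefficient of every monomial.

Polynomial : ℕ → Set
Polynomial v = List (ℚ × Vec ℕ v)

coeff : ∀ {v} → Polynomial v → Vec ℕ v → ℚ
coeff []            e = 0ℚ
coeff ((c , d) ∷ p) e = (if does (Vec.≡-dec ℕ._≟_ d e) then c else 0ℚ) ℚ.+ coeff p e

polynomialRawSemiring : ℕ → RawSemiring 0ℓ 0ℓ
polynomialRawSemiring v = record
  { Carrier = Polynomial v
  ; _≈_     = λ p q → ∀ e → coeff p e ≡ coeff q e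
  ; _+_     = _++_
  ; _*_     = cartesianProductWith λ (c , d) (c′ , d′) → c ℚ.* c′ , zipWith ℕ._+_ d d′
  ; 0#      = []
  ; 1#      = (1ℚ , replicate v 0) ∷ []
  }

ℚ[x,y,α] : Set
ℚ[x,y,α] = Polynomial 3

open RawSemiring (polynomialRawSemiring 3) public using (_≈_; _+_; _*_; 0#)
open RawSemiringDefs (polynomialRawSemiring 3) public using (_^_)

const : ℚ → ℚ[x,y,α]
const c = (c , replicate 3 0) ∷ []

var : Fin 3 → ℚ[x,y,α]
var i = (1ℚ , replicate 3 0 [ i ]≔ 1) ∷ []

x y α : ℚ[x,y,α]
x = var Fin.zero
y = var (Fin.suc Fin.zero)
α = var (Fin.suc (Fin.suc Fin.zero))

∑ : {A : Set} → List A → (A → ℚ[x,y,α]) → ℚ[x,y,α]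
∑ as f = foldr _+_ 0# (map f as)

------------------------------------------------------------------------
-- The symmetric group as a finite list

-- Every permutation of suc n letters is obtained in exactly one way by placing
-- the largest letter at a position i of a permutation of n letters.

𝔖 : ∀ n → List (Permutation′ n)
𝔖 zero    = Perm.id ∷ []
𝔖 (suc n) = cartesianProductWith (λ i → insert i (fromℕ n)) (allFin (suc n)) (𝔖 n)

insert-at : ∀ {n} i j (π : Permutation′ n) → insert i j π ⟨$⟩ʳ i ≡ j
insert-at i j π with i Fin.≟ i
... | yes _  = refl
... | no i≢i = contradiction refl i≢i

permutationSetoid : ℕ → Setoid 0ℓ 0ℓ
permutationSetoid n = record
  { Carrier       = Permutation′ n
  ; _≈_           = Perm._≈_
  ; isEquivalence = record
    { refl  = λ _ → refl
    ; sym   = λ p i → sym (p i)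
    ; trans = λ p q i → trans (p i) (q i)
    }
  }

private
  insert-cong : ∀ {n} {i i′} {j} {π ρ : Permutation′ n} →
                i ≡ i′ → π Perm.≈ ρ → insert i j π Perm.≈ insert i′ j ρ
  insert-cong {i = i} {j = j} {π} {ρ} refl π≈ρ k with i Fin.≟ k
  ... | yes _ = refl
  ... | no  _ = cong (punchIn j) (π≈ρ _)

  insert-injective : ∀ {n} {i i′} {j} {π ρ : Permutation′ n} →
                     insert i j π Perm.≈ insert i′ j ρ → i ≡ i′ × π Perm.≈ ρ
  insert-injective {i = i} {i′} {j} {π} {ρ} eq = i≡i′ , helper i≡i′
    where
    open ≡-Reasoning
    i≡i′ : i ≡ i′
    i≡i′ = begin
      i                                              ≡⟨ inverseˡ (insert i′ j ρ) ⟨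
      insert i′ j ρ ⟨$⟩ˡ (insert i′ j ρ ⟨$⟩ʳ i)   ≡⟨ cong (insert i′ j ρ ⟨$⟩ˡ_) (trans (sym (eq i)) (insert-at i j π)) ⟩
      insert i′ j ρ ⟨$⟩ˡ j                          ≡⟨ cong (insert i′ j ρ ⟨$⟩ˡ_) (insert-at i′ j ρ) ⟨
      insert i′ j ρ ⟨$⟩ˡ (insert i′ j ρ ⟨$⟩ʳ i′)  ≡⟨ inverseˡ (insert i′ j ρ) ⟩
      i′                                             ∎
    helper : i ≡ i′ → π Perm.≈ ρ
    helper refl k = Fin.punchIn-injective j _ _ (begin
      punchIn j (π ⟨$⟩ʳ k)             ≡⟨ insert-punchIn i j π k ⟨
      insert i j π ⟨$⟩ʳ punchIn i k    ≡⟨ eq (punchIn i k) ⟩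
      insert i j ρ ⟨$⟩ʳ punchIn i k    ≡⟨ insert-punchIn i j ρ k ⟩
      punchIn j (ρ ⟨$⟩ʳ k)             ∎)

-- 𝔖 n lists every permutation exactly once, up to pointwise equality.

𝔖-complete : ∀ n (π : Permutation′ n) → Membership._∈_ (permutationSetoid n) π (𝔖 n)
𝔖-complete zero    π = here λ ()
𝔖-complete (suc n) π = Membershipₚ.∈-resp-≈ (permutationSetoid (suc n))
  {x = insert i (fromℕ n) (remove i π)} {y = π} insert≈π
  (Membershipₚ.∈-cartesianProductWith⁺ (setoid (Fin (suc n))) (permutationSetoid n)
    (permutationSetoid (suc n)) {f = λ j → insert j (fromℕ n)}
    (λ {_} {_} {π} {ρ} → insert-cong {π = π} {ρ})
    (∈-allFin i) (𝔖-complete n (remove i π)))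
  where
  i : Fin (suc n)
  i = π ⟨$⟩ˡ fromℕ n
  insert≈π : insert i (fromℕ n) (remove i π) Perm.≈ π
  insert≈π k = trans (cong (λ j → insert i j (remove i π) ⟨$⟩ʳ k) (sym (inverseʳ π)))
                     (insert-remove i π k)

𝔖-unique : ∀ n → Unique.Unique (permutationSetoid n) (𝔖 n)
𝔖-unique zero    = [] ∷ []
𝔖-unique (suc n) = Uniqueₚ.cartesianProductWith⁺
  (setoid (Fin (suc n))) (permutationSetoid n) (permutationSetoid (suc n))
  (λ i → insert i (fromℕ n)) (λ {_} {_} {π} {ρ} → insert-injective {π = π} {ρ = ρ})
  (allFin⁺ (suc n)) (𝔖-unique n)

------------------------------------------------------------------------
-- Permutation statistics

-- The letter σᵢ for a 1-based position i, with values in {1,…,n}; positions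
-- outside {1,…,n}, in particular 0 and n+1, carry the letter ⊤⁺ = +∞.

infix 8 _‼_
_‼_ : ∀ {n} → Permutation′ n → ℕ → ℕ ⁺
σ ‼ zero = ⊤⁺
_‼_ {n} σ (suc i) with i ℕ.<? n
... | yes i<n = [ suc (toℕ (σ ⟨$⟩ʳ fromℕ< i<n)) ]
... | no  _   = ⊤⁺

-- {a, a+1, …, b}, empty when a > b

[_⋯_] : ℕ → ℕ → List ℕ
[ a ⋯ b ] = applyUpTo (a ℕ.+_) (suc b ∸ a)

infix 4 _<⁺?_
_<⁺?_ : ∀ a b → Dec (a <⁺ b)
_<⁺?_ = <⁺-dec ℕ._<?_

count : {P : Pred ℕ 0ℓ} → Decidable P → List ℕ → ℕ
count P? is = length (filter P? is)

module _ {n} (σ : Permutation′ n) where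

  IsDescent IsAscent IsLRmin IsRLmin IsDoubleAscent IsDoubleDescent IsPeak : Pred ℕ 0ℓ
  IsDescent       i = σ ‼ suc i <⁺ σ ‼ i
  IsAscent        i = σ ‼ i <⁺ σ ‼ suc i
  IsLRmin         i = All (λ j → σ ‼ i <⁺ σ ‼ j) [ 1 ⋯ pred i ]
  IsRLmin         i = All (λ j → σ ‼ i <⁺ σ ‼ j) [ suc i ⋯ n ]
  IsDoubleAscent  i = σ ‼ pred i <⁺ σ ‼ i × σ ‼ i <⁺ σ ‼ suc i
  IsDoubleDescent i = σ ‼ i <⁺ σ ‼ pred i × σ ‼ suc i <⁺ σ ‼ i
  IsPeak          i = σ ‼ pred i <⁺ σ ‼ i × σ ‼ suc i <⁺ σ ‼ i

  isDescent? : Decidable IsDescent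
  isDescent? i = σ ‼ suc i <⁺? σ ‼ i

  isAscent? : Decidable IsAscent
  isAscent? i = σ ‼ i <⁺? σ ‼ suc i

  isLRmin? : Decidable IsLRmin
  isLRmin? i = all? (λ j → σ ‼ i <⁺? σ ‼ j) [ 1 ⋯ pred i ]

  isRLmin? : Decidable IsRLmin
  isRLmin? i = all? (λ j → σ ‼ i <⁺? σ ‼ j) [ suc i ⋯ n ]

  isDoubleAscent? : Decidable IsDoubleAscent
  isDoubleAscent? i = σ ‼ pred i <⁺? σ ‼ i ×-dec σ ‼ i <⁺? σ ‼ suc i

  isDoubleDescent? : Decidable IsDoubleDescent
  isDoubleDescent? i = σ ‼ i <⁺? σ ‼ pred i ×-dec σ ‼ suc i <⁺? σ ‼ i

  isPeak? : Decidable IsPeak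
  isPeak? i = σ ‼ pred i <⁺? σ ‼ i ×-dec σ ‼ suc i <⁺? σ ‼ i

  des asc LRmin RLmin peaks : ℕ
  des   = count isDescent? [ 1 ⋯ n ∸ 1 ]
  asc   = count isAscent?  [ 1 ⋯ n ∸ 1 ]
  LRmin = count isLRmin?   [ 1 ⋯ n ]
  RLmin = count isRLmin?   [ 1 ⋯ n ]
  peaks = count isPeak?    [ 1 ⋯ n ]

  NoDoubleAscent : Set
  NoDoubleAscent = All (λ i → ¬ IsDoubleAscent i) [ 1 ⋯ n ]

  -- Interior positions 1 < i < n only: the boundary letters +∞ play no role.
  NoInteriorDoubleDescent : Set
  NoInteriorDoubleDescent = All (λ i → ¬ IsDoubleDescent i) [ 2 ⋯ n ∸ 1 ]

  IsFirstAscent : Pred ℕ 0ℓ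
  IsFirstAscent i = IsAscent i × All (λ j → ¬ IsAscent j) [ 1 ⋯ pred i ]

  IsPRW : Set
  IsPRW = All (λ i → IsFirstAscent i → σ ‼ i ≡ [ 1 ]) [ 1 ⋯ n ∸ 1 ]

  noDoubleAscent? : Dec NoDoubleAscent
  noDoubleAscent? = all? (λ i → ¬? (isDoubleAscent? i)) _

  noInteriorDoubleDescent? : Dec NoInteriorDoubleDescent
  noInteriorDoubleDescent? = all? (λ i → ¬? (isDoubleDescent? i)) _

  isPRW? : Dec IsPRW
  isPRW? = all? (λ i → (isAscent? i ×-dec all? (λ j → ¬? (isAscent? j)) _)
                       →-dec ≡-dec ℕ._≟_ (σ ‼ i) [ 1 ]) _

PRW : ∀ n → List (Permutation′ n)
PRW n = filter isPRW? (𝔖 n)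

Γ⁽¹⁾ Γ⁽²⁾ : ∀ n → ℕ → List (Permutation′ (suc n))
Γ⁽¹⁾ n k = filter (λ σ → (asc σ ℕ.≟ k) ×-dec noDoubleAscent? σ) (PRW (suc n))
Γ⁽²⁾ n k = filter (λ σ → peaks σ ℕ.≟ k) (PRW (suc n))

Γ⁽³⁾ : ∀ n → ℕ → List (Permutation′ n)
Γ⁽³⁾ n k = filter (λ σ → (des σ ℕ.≟ k) ×-dec noInteriorDoubleDescent? σ) (𝔖 n)

-- LRmin + RLmin − 2. The truncated subtraction is exact for words of positive
-- length, where the letter 1 is a minimum of both kinds.

minWeight : ∀ {n} → Permutation′ n → ℕ
minWeight σ = (LRmin σ ℕ.+ RLmin σ) ∸ 2

Ã : ℕ → ℚ[x,y,α]
Ã n = ∑ (PRW (suc n)) λ σ → x ^ des σ * y ^ asc σ * α ^ minWeight σ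

{-# OPTIONS --safe #-}
module Submission where

-- PRW words are those of the form (decreasing prefix) 1 w.  Inserting a new
-- largest letter into such a word acts on its numbers of peaks (P), double
-- descents (X), double ascents (Y) and of minima (α) like the operator
-- αX + αY + D, where D is the derivation with D P = P (X + Y) and
-- D X = D Y = P.  Double descents of the prefix are inert under D, so they are
-- tracked by a separate constant a in place of X.  With v = X + Y and
-- c = Y + a the operator becomes αc + D with D v = 2P, D c = P and D P = P v,
-- in which X and Y no longer occur; setting a = X also gives c = v.  Hence the
-- generating function of PRW words depends on X and Y through X + Y only, and
-- each claim compares two pairs with the same sum: (x , y) or (1 , 1) or (0 , 1)
-- against one whose second entry is 0.  In the case (0 , 1) the prefix is empty,
-- and dropping the initial 1 leaves an arbitrary permutation.

open import Algebra.Bundles using (CommutativeMonoid; CommutativeSemiring; RawSemiring)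
import Algebra.Definitions.RawSemiring as RawSemiringDefs
import Algebra.Properties.CommutativeMonoid.Mult as Multₚ
import Algebra.Properties.CommutativeSemigroup as CommutativeSemigroupₚ
import Algebra.Properties.CommutativeSemiring.Exp as Expₚ
import Algebra.Solver.Ring.NaturalCoefficients.Default as SemiringSolver
open import Algebra.Structures.Biased using (isCommutativeSemiringˡ)
open import Data.Bool using (Bool; true; false; if_then_else_; not; _∧_; _∨_)
import Data.Bool.Properties as Bool
open import Data.Fin as Fin using (Fin; toℕ; fromℕ; fromℕ<; punchIn)
open import Data.Fin.Permutation
  using (Permutation′; _⟨$⟩ʳ_; _⟨$⟩ˡ_; insert; inverseʳ; inverseˡ; insert-punchIn)
import Data.Fin.Properties as Fin
open import Data.List
  using (List; []; _∷_; _++_; map; foldr; filter; length; tabulate; allFin; applyUpTo; upTo; cartesianProductWith)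
open import Data.List.Membership.Propositional using (_∈_)
import Data.List.Membership.Propositional.Properties as Membership
import Data.List.Properties as List
open import Data.List.Relation.Unary.All as All using (All; []; _∷_; all?)
import Data.List.Relation.Unary.All.Properties as All
open import Data.List.Relation.Unary.AllPairs using ([]; _∷_)
open import Data.List.Relation.Unary.Any using (here; there)
open import Data.List.Relation.Unary.Unique.Propositional using (Unique)
import Data.List.Relation.Unary.Unique.Propositional.Properties as Unique
open import Data.Nat as ℕ using (ℕ; zero; suc; pred; _∸_; _<_; _≤_; _<ᵇ_; _≡ᵇ_; ⌊_/2⌋) renaming (_*_ to _*ℕ_)
import Data.Nat.Properties as ℕ
open import Data.Nat.Tactic.RingSolver using (solve-∀)
open import Data.Product using (_×_; _,_; proj₁; proj₂; ∃; Σ-syntax)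
open import Data.Rational as ℚ using (ℚ; 0ℚ; 1ℚ; ½)
import Data.Rational.Properties as ℚ
open import Data.Vec as Vec using (Vec; []; _∷_; zipWith)
import Data.Vec.Properties as Vec
import Defs
open import Function using (_∘_)
open import Level using (0ℓ)
open import Relation.Binary.Definitions using (tri<; tri≈; tri>)
import Relation.Binary.PropositionalEquality as ≡
import Relation.Binary.Reasoning.Setoid as SetoidReasoning
open import Relation.Binary.Structures using (IsEquivalence)
open import Relation.Nullary using (Dec; yes; no; does; contradiction)
open import Relation.Nullary.Construct.Add.Supremum using (_⁺; ⊤⁺; [_]; ≡-dec)
open import Relation.Nullary.Decidable using (dec-true; dec-false; map′; _×-dec_)

-- The coefficient semiring has no indeterminates P, X, Y, a on which the operator could act, so the
-- argument is carried out dually. A `State` is a monomial in P, X, Y, a and α, a `Functional` is a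
-- linear functional on the span of these monomials, and `L` is the transpose of αc + D; a sum over
-- PRW words becomes `iterate L n f` at the monomial 1. That X and Y disappear then means: the
-- subalgebra generated by P, v, αc and α contains 1 and is mapped to itself by αc + D, so two
-- functionals that agree on this subalgebra give the same sum. D sends each generator to a sum of
-- products of generators without any sign, so identities valid in a commutative semiring suffice
-- and no subtraction occurs.

-- Polynomials form a commutative semiring.

module PolynomialSemiring where

  open Defs using (Polynomial; coeff; polynomialRawSemiring)
  open ≡ hiding (isEquivalence)

  private
    ℚ-interchange : ∀ a b c d → (a ℚ.+ b) ℚ.+ (c ℚ.+ d) ≡ (a ℚ.+ c) ℚ.+ (b ℚ.+ d)
    ℚ-interchange = CommutativeSemigroupₚ.interchange
      (CommutativeMonoid.commutativeSemigroup ℚ.+-0-commutativeMonoid)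

  module _ {v : ℕ} where

    private
      module P = RawSemiring (polynomialRawSemiring v)

    -- The linear functional with value g d on the monomial of exponent d.
    integral : Polynomial v → (Vec ℕ v → ℚ) → ℚ
    integral []            g = 0ℚ
    integral ((c , d) ∷ p) g = c ℚ.* g d ℚ.+ integral p g

    indicator : Vec ℕ v → Vec ℕ v → ℚ
    indicator e d = if does (Vec.≡-dec ℕ._≟_ d e) then 1ℚ else 0ℚ

    coeff≡integral : ∀ p e → coeff p e ≡ integral p (indicator e)
    coeff≡integral []            e = refl
    coeff≡integral ((c , d) ∷ p) e with Vec.≡-dec ℕ._≟_ d e
    ... | yes _ = cong₂ ℚ._+_ (sym (ℚ.*-identityʳ c)) (coeff≡integral p e)
    ... | no  _ = cong₂ ℚ._+_ (sym (ℚ.*-zeroʳ c)) (coeff≡integral p e)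

    integral-cong : ∀ p {g h} → (∀ d → g d ≡ h d) → integral p g ≡ integral p h
    integral-cong []            g≗h = refl
    integral-cong ((c , d) ∷ p) g≗h = cong₂ (λ a b → c ℚ.* a ℚ.+ b) (g≗h d) (integral-cong p g≗h)

    integral-zero : ∀ p → integral p (λ _ → 0ℚ) ≡ 0ℚ
    integral-zero []            = refl
    integral-zero ((c , d) ∷ p) = cong₂ ℚ._+_ (ℚ.*-zeroʳ c) (integral-zero p)

    integral-+ : ∀ p g h → integral p (λ d → g d ℚ.+ h d) ≡ integral p g ℚ.+ integral p h
    integral-+ []            g h = refl
    integral-+ ((c , d) ∷ p) g h = trans
      (cong₂ ℚ._+_ (ℚ.*-distribˡ-+ c (g d) (h d)) (integral-+ p g h))
      (ℚ-interchange (c ℚ.* g d) (c ℚ.* h d) (integral p g) (integral p h))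

    integral-* : ∀ p c g → integral p (λ d → c ℚ.* g d) ≡ c ℚ.* integral p g
    integral-* []            c g = sym (ℚ.*-zeroʳ c)
    integral-* ((b , d) ∷ p) c g = begin
      b ℚ.* (c ℚ.* g d) ℚ.+ integral p (λ d → c ℚ.* g d)  ≡⟨ cong₂ ℚ._+_ swap (integral-* p c g) ⟩
      c ℚ.* (b ℚ.* g d) ℚ.+ c ℚ.* integral p g            ≡⟨ ℚ.*-distribˡ-+ c (b ℚ.* g d) (integral p g) ⟨
      c ℚ.* (b ℚ.* g d ℚ.+ integral p g)                  ∎
      where
      open ≡-Reasoning
      swap : b ℚ.* (c ℚ.* g d) ≡ c ℚ.* (b ℚ.* g d)
      swap = trans (sym (ℚ.*-assoc b c (g d))) (trans (cong (ℚ._* g d) (ℚ.*-comm b c)) (ℚ.*-assoc c b (g d)))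

    integral-swap : ∀ p q (h : Vec ℕ v → Vec ℕ v → ℚ) →
      integral p (λ d → integral q (h d)) ≡ integral q (λ d′ → integral p (λ d → h d d′))
    integral-swap []            q h = sym (integral-zero q)
    integral-swap ((c , d) ∷ p) q h = begin
      c ℚ.* integral q (h d) ℚ.+ integral p (λ d → integral q (h d))
        ≡⟨ cong₂ ℚ._+_ (sym (integral-* q c (h d))) (integral-swap p q h) ⟩
      integral q (λ d′ → c ℚ.* h d d′) ℚ.+ integral q (λ d′ → integral p (λ d → h d d′))
        ≡⟨ integral-+ q _ _ ⟨
      integral q (λ d′ → c ℚ.* h d d′ ℚ.+ integral p (λ d → h d d′)) ∎
      where open ≡-Reasoning

    integral-++ : ∀ p q g → integral (p ++ q) g ≡ integral p g ℚ.+ integral q g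
    integral-++ []            q g = sym (ℚ.+-identityˡ _)
    integral-++ ((c , d) ∷ p) q g =
      trans (cong (c ℚ.* g d ℚ.+_) (integral-++ p q g)) (sym (ℚ.+-assoc (c ℚ.* g d) _ _))

    -- Turns a product of polynomials into an iterated integral over exponent vectors, so that the
    -- laws of multiplication reduce to those of vector addition, with `integral-swap` exchanging
    -- the two integrals for commutativity.
    integral-product : ∀ p q g →
      integral (p P.* q) g ≡ integral p (λ d → integral q (λ d′ → g (zipWith ℕ._+_ d d′)))
    integral-product []            q g = refl
    integral-product ((c , d) ∷ p) q g = trans (integral-++ (map _ q) (p P.* q) g)
      (cong₂ ℚ._+_ (monomial q) (integral-product p q g))
      where
      monomial : ∀ q → integral (map (λ (c′ , d′) → c ℚ.* c′ , zipWith ℕ._+_ d d′) q) g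
                     ≡ c ℚ.* integral q (λ d′ → g (zipWith ℕ._+_ d d′))
      monomial []              = sym (ℚ.*-zeroʳ c)
      monomial ((c′ , d′) ∷ q) = begin
        c ℚ.* c′ ℚ.* g″ ℚ.+ integral (map _ q) g  ≡⟨ cong₂ ℚ._+_ (ℚ.*-assoc c c′ g″) (monomial q) ⟩
        c ℚ.* (c′ ℚ.* g″) ℚ.+ c ℚ.* integral q _  ≡⟨ ℚ.*-distribˡ-+ c (c′ ℚ.* g″) _ ⟨
        c ℚ.* (c′ ℚ.* g″ ℚ.+ integral q _)        ∎
        where
        open ≡-Reasoning
        g″ = g (zipWith ℕ._+_ d d′)

  zipWith-+-cancelˡ : ∀ {v} (d : Vec ℕ v) {e e′} → zipWith ℕ._+_ d e ≡ zipWith ℕ._+_ d e′ → e ≡ e′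
  zipWith-+-cancelˡ []      {[]}    {[]}     eq = refl
  zipWith-+-cancelˡ (n ∷ d) {_ ∷ _} {_ ∷ _}  eq =
    cong₂ _∷_ (ℕ.+-cancelˡ-≡ n _ _ (Vec.∷-injectiveˡ eq)) (zipWith-+-cancelˡ d (Vec.∷-injectiveʳ eq))

  infix 4 _∣ᵐ?_
  _∣ᵐ?_ : ∀ {v} (d e : Vec ℕ v) → Dec (∃ λ e′ → zipWith ℕ._+_ d e′ ≡ e)
  []      ∣ᵐ? []      = yes ([] , refl)
  (m ∷ d) ∣ᵐ? (n ∷ e) = map′
    (λ ((k , p) , (e′ , q)) → k ∷ e′ , cong₂ _∷_ p q)
    (λ { (k ∷ e′ , eq) → (k , Vec.∷-injectiveˡ eq) , (e′ , Vec.∷-injectiveʳ eq) })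
    (difference? ×-dec (d ∣ᵐ? e))
    where
    difference? : Dec (∃ λ k → m ℕ.+ k ≡ n)
    difference? = map′ (λ m≤n → n ℕ.∸ m , ℕ.m+[n∸m]≡n m≤n)
                       (λ { (k , refl) → ℕ.m≤m+n m k }) (m ℕ.≤? n)

  module _ {v : ℕ} where

    private
      module P = RawSemiring (polynomialRawSemiring v)

    indicator-yes : ∀ {d e : Vec ℕ v} → d ≡ e → indicator e d ≡ 1ℚ
    indicator-yes {d} {e} d≡e with Vec.≡-dec ℕ._≟_ d e
    ... | yes _  = refl
    ... | no d≢e = contradiction d≡e d≢e

    indicator-no : ∀ {d e : Vec ℕ v} → d ≢ e → indicator e d ≡ 0ℚ
    indicator-no {d} {e} d≢e with Vec.≡-dec ℕ._≟_ d e
    ... | yes d≡e = contradiction d≡e d≢e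
    ... | no _    = refl

    indicator-shift : ∀ d e d′ → indicator (zipWith ℕ._+_ d e) (zipWith ℕ._+_ d d′) ≡ indicator e d′
    indicator-shift d e d′ with Vec.≡-dec ℕ._≟_ d′ e
    ... | yes refl = indicator-yes {zipWith ℕ._+_ d e} refl
    ... | no d′≢e  = indicator-no λ eq → d′≢e (zipWith-+-cancelˡ d eq)

    -- Congruence of multiplication by a single monomial. The hypothesis speaks only of integrals
    -- against indicators; a translated indicator is again an indicator if `d` divides `e` and is
    -- zero otherwise, hence the decision by `_∣ᵐ?_`.
    integral-shift-cong : ∀ {p q} → p P.≈ q → ∀ d e →
      integral p (λ d′ → indicator e (zipWith ℕ._+_ d d′)) ≡
      integral q (λ d′ → indicator e (zipWith ℕ._+_ d d′))
    integral-shift-cong {p} {q} p≈q d e with d ∣ᵐ? e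
    ... | yes (e′ , refl) = trans (shift p) (trans (p≈q e′) (sym (shift q)))
      where
      shift : ∀ p → integral p (λ d′ → indicator (zipWith ℕ._+_ d e′) (zipWith ℕ._+_ d d′)) ≡ coeff p e′
      shift p = trans (integral-cong p (indicator-shift d e′)) (sym (coeff≡integral p e′))
    ... | no ∄e′ = trans (vanish p) (sym (vanish q))
      where
      vanish : ∀ p → integral p (λ d′ → indicator e (zipWith ℕ._+_ d d′)) ≡ 0ℚ
      vanish p = trans (integral-cong p λ d′ → indicator-no λ eq → ∄e′ (d′ , eq)) (integral-zero p)

    private
      from-integral : ∀ p q → (∀ g → integral p g ≡ integral q g) → p P.≈ q
      from-integral p q eq e = trans (coeff≡integral p e) (trans (eq _) (sym (coeff≡integral q e)))

      coeff-++ : ∀ (p q : Polynomial v) e → coeff (p ++ q) e ≡ coeff p e ℚ.+ coeff q e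
      coeff-++ p q e rewrite coeff≡integral (p ++ q) e | coeff≡integral p e | coeff≡integral q e =
        integral-++ p q (indicator e)

      +-cong : ∀ {p p′ q q′} → p P.≈ p′ → q P.≈ q′ → (p P.+ q) P.≈ (p′ P.+ q′)
      +-cong {p} {p′} {q} {q′} p≈ q≈ e =
        trans (coeff-++ p q e) (trans (cong₂ ℚ._+_ (p≈ e) (q≈ e)) (sym (coeff-++ p′ q′ e)))

      +-assoc : ∀ p q r → ((p P.+ q) P.+ r) P.≈ (p P.+ (q P.+ r))
      +-assoc p q r = from-integral ((p ++ q) ++ r) (p ++ (q ++ r)) λ g → begin
        integral ((p ++ q) ++ r) g                             ≡⟨ integral-++ (p ++ q) r g ⟩
        integral (p ++ q) g ℚ.+ integral r g                   ≡⟨ cong (ℚ._+ integral r g) (integral-++ p q g) ⟩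
        integral p g ℚ.+ integral q g ℚ.+ integral r g         ≡⟨ ℚ.+-assoc (integral p g) _ _ ⟩
        integral p g ℚ.+ (integral q g ℚ.+ integral r g)       ≡⟨ cong (integral p g ℚ.+_) (integral-++ q r g) ⟨
        integral p g ℚ.+ integral (q ++ r) g                   ≡⟨ integral-++ p (q ++ r) g ⟨
        integral (p ++ (q ++ r)) g                             ∎
        where open ≡-Reasoning

      +-comm : ∀ p q → (p P.+ q) P.≈ (q P.+ p)
      +-comm p q e = trans (coeff-++ p q e) (trans (ℚ.+-comm (coeff p e) _) (sym (coeff-++ q p e)))

      *-comm : ∀ p q → (p P.* q) P.≈ (q P.* p)
      *-comm p q = from-integral (p P.* q) (q P.* p) λ g → begin
        integral (p P.* q) g                                              ≡⟨ integral-product p q g ⟩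
        integral p (λ d → integral q (λ d′ → g (zipWith ℕ._+_ d d′)))     ≡⟨ integral-swap p q _ ⟩
        integral q (λ d′ → integral p (λ d → g (zipWith ℕ._+_ d d′)))
          ≡⟨ integral-cong q (λ d′ → integral-cong p λ d → cong g (Vec.zipWith-comm ℕ.+-comm d d′)) ⟩
        integral q (λ d′ → integral p (λ d → g (zipWith ℕ._+_ d′ d)))     ≡⟨ integral-product q p g ⟨
        integral (q P.* p) g                                              ∎
        where open ≡-Reasoning

      *-congʳ : ∀ p {q q′} → q P.≈ q′ → (p P.* q) P.≈ (p P.* q′)
      *-congʳ p {q} {q′} q≈ e = begin
        coeff (p P.* q) e                          ≡⟨ coeff≡integral (p P.* q) e ⟩
        integral (p P.* q) (indicator e)           ≡⟨ integral-product p q _ ⟩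
        integral p (λ d → integral q (λ d′ → indicator e (zipWith ℕ._+_ d d′)))
          ≡⟨ integral-cong p (λ d → integral-shift-cong {q} {q′} q≈ d e) ⟩
        integral p (λ d → integral q′ (λ d′ → indicator e (zipWith ℕ._+_ d d′)))
                                                   ≡⟨ integral-product p q′ _ ⟨
        integral (p P.* q′) (indicator e)          ≡⟨ coeff≡integral (p P.* q′) e ⟨
        coeff (p P.* q′) e                         ∎
        where open ≡-Reasoning

      *-cong : ∀ {p p′ q q′} → p P.≈ p′ → q P.≈ q′ → (p P.* q) P.≈ (p′ P.* q′)
      *-cong {p} {p′} {q} {q′} p≈ q≈ e = trans (*-congʳ p q≈ e)
        (trans (*-comm p q′ e) (trans (*-congʳ q′ p≈ e) (*-comm q′ p′ e)))

      *-assoc : ∀ p q r → ((p P.* q) P.* r) P.≈ (p P.* (q P.* r))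
      *-assoc p q r = from-integral ((p P.* q) P.* r) (p P.* (q P.* r)) λ g → begin
        integral ((p P.* q) P.* r) g                               ≡⟨ integral-product (p P.* q) r g ⟩
        integral (p P.* q) _                                       ≡⟨ integral-product p q _ ⟩
        integral p (λ d → integral q (λ d′ → integral r (λ d″ → g (zipWith ℕ._+_ (zipWith ℕ._+_ d d′) d″))))
          ≡⟨ integral-cong p (λ d → integral-cong q λ d′ → integral-cong r λ d″ →
               cong g (Vec.zipWith-assoc ℕ.+-assoc d d′ d″)) ⟩
        integral p (λ d → integral q (λ d′ → integral r (λ d″ → g (zipWith ℕ._+_ d (zipWith ℕ._+_ d′ d″)))))
          ≡⟨ integral-cong p (λ d → integral-product q r _) ⟨
        integral p (λ d → integral (q P.* r) (λ d′ → g (zipWith ℕ._+_ d d′)))  ≡⟨ integral-product p (q P.* r) g ⟨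
        integral (p P.* (q P.* r)) g                               ∎
        where open ≡-Reasoning

      *-identityˡ : ∀ p → (P.1# P.* p) P.≈ p
      *-identityˡ p = from-integral (P.1# P.* p) p λ g → begin
        integral (P.1# P.* p) g      ≡⟨ integral-product P.1# p g ⟩
        1ℚ ℚ.* integral p _ ℚ.+ 0ℚ   ≡⟨ ℚ.+-identityʳ _ ⟩
        1ℚ ℚ.* integral p _          ≡⟨ ℚ.*-identityˡ _ ⟩
        integral p _                 ≡⟨ integral-cong p (λ d → cong g (Vec.zipWith-identityˡ ℕ.+-identityˡ d)) ⟩
        integral p g                 ∎
        where open ≡-Reasoning

      *-distribʳ : ∀ p q r → ((q P.+ r) P.* p) P.≈ ((q P.* p) P.+ (r P.* p))
      *-distribʳ p q r = from-integral ((q ++ r) P.* p) ((q P.* p) ++ (r P.* p)) λ g → begin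
        integral ((q ++ r) P.* p) g                        ≡⟨ integral-product (q ++ r) p g ⟩
        integral (q ++ r) _                                ≡⟨ integral-++ q r _ ⟩
        integral q _ ℚ.+ integral r _                      ≡⟨ cong₂ ℚ._+_ (integral-product q p g) (integral-product r p g) ⟨
        integral (q P.* p) g ℚ.+ integral (r P.* p) g      ≡⟨ integral-++ (q P.* p) (r P.* p) g ⟨
        integral ((q P.* p) ++ (r P.* p)) g                ∎
        where open ≡-Reasoning

      ≈-isEquivalence : IsEquivalence P._≈_
      ≈-isEquivalence = record
        { refl = λ e → refl ; sym = λ p e → sym (p e) ; trans = λ p q e → trans (p e) (q e) }

    polynomialCommutativeSemiring : CommutativeSemiring 0ℓ 0ℓ
    polynomialCommutativeSemiring = record
      { RawSemiring (polynomialRawSemiring v)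
      ; isCommutativeSemiring = isCommutativeSemiringˡ record
        { +-isCommutativeMonoid = record
          { isMonoid = record
            { isSemigroup = record
              { isMagma = record
                { isEquivalence = ≈-isEquivalence
                ; ∙-cong = λ {p} {p′} {q} {q′} → +-cong {p} {p′} {q} {q′}
                }
              ; assoc = +-assoc
              }
            ; identity = (λ p e → refl) , λ p e → trans (coeff-++ p [] e) (ℚ.+-identityʳ _)
            }
          ; comm = +-comm
          }
        ; *-isCommutativeMonoid = record
          { isMonoid = record
            { isSemigroup = record
              { isMagma = record
                { isEquivalence = ≈-isEquivalence
                ; ∙-cong = λ {p} {p′} {q} {q′} → *-cong {p} {p′} {q} {q′}
                }
              ; assoc = *-assoc
              }
            ; identity = *-identityˡ , λ p e → trans (*-comm p P.1# e) (*-identityˡ p e)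
            }
          ; comm = *-comm
          }
        ; distribʳ = *-distribʳ
        ; zeroˡ = λ p e → refl
        }
      }

-- Words, their states, and the insertion of a new largest letter.

module Insertion where

  open ≡ using (_≡_)

  -- The exponents of P, X, Y, a and α. A letter before 1 is at once a double descent and a
  -- left-to-right minimum, so `#prefix` serves for both. In `statistics` the letter 1 enters no
  -- count, which accounts for the subtraction of 2 in `minWeight`.
  record State : Set where
    constructor state
    field
      #peak #doubleDescent #doubleAscent #prefix #rightMin : ℕ

  open State

  ∅ : State
  ∅ = state 0 0 0 0 0

  +peak +descent +ascent +prefix +rightMin : State → State
  +peak     (state p d a l r) = state (suc p) d a l r
  +descent  (state p d a l r) = state p (suc d) a l r
  +ascent   (state p d a l r) = state p d (suc a) l r
  +prefix   (state p d a l r) = state p d a (suc l) r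
  +rightMin (state p d a l r) = state p d a l (suc r)

  -- The first Boolean says whether the left neighbour is smaller, the second one
  -- whether the right neighbour is larger. Valleys are not recorded.
  classify : Bool → Bool → State → State
  classify true  true  = +ascent
  classify true  false = +peak
  classify false true  = λ s → s
  classify false false = +descent

  below : ℕ → List ℕ → Bool
  below a []      = true
  below a (c ∷ w) = a <ᵇ c

  isRightMin : ℕ → List ℕ → Bool
  isRightMin a w = does (all? (a ℕ.<?_) w)

  markRightMin : Bool → State → State
  markRightMin r s = if r then +rightMin s else s

  -- The word w is placed between a left neighbour b and a right neighbour +∞.
  interior : ℕ → List ℕ → State
  interior b []      = ∅
  interior b (a ∷ w) = classify (b <ᵇ a) (below a w) (markRightMin (isRightMin a w) (interior a w))

  -- Words without the letter 1 are rejected; permutations always contain it.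
  prw : List ℕ → Bool
  prw []      = false
  prw (a ∷ w) = if a ≡ᵇ 1 then true else not (below a w) ∧ prw w

  -- The left neighbour 0 stands for the letter 1, so that interior 0 also serves
  -- for arbitrary permutations.
  statistics : List ℕ → State
  statistics []      = ∅
  statistics (a ∷ w) = if a ≡ᵇ 1 then interior 0 w else +prefix (statistics w)

  insertions later : ℕ → List ℕ → List (List ℕ)
  insertions N w  = (N ∷ w) ∷ later N w
  later N []      = []
  later N (a ∷ w) = map (a ∷_) (insertions N w)

  <⇒<ᵇ≡true : ∀ {m n} → m < n → (m <ᵇ n) ≡ true
  <⇒<ᵇ≡true {m} {n} = dec-true (m ℕ.<? n)

  <⇒>ᵇ≡false : ∀ {m n} → m < n → (n <ᵇ m) ≡ false
  <⇒>ᵇ≡false {m} {n} m<n = dec-false (n ℕ.<? m) (ℕ.<-asym m<n)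

  below-zero : ∀ w → All (0 <_) w → below 0 w ≡ true
  below-zero []      []        = ≡.refl
  below-zero (c ∷ w) (0<c ∷ _) = <⇒<ᵇ≡true 0<c

  isRightMin-insertions : ∀ {a N} w → a < N →
    All (λ w′ → isRightMin a w′ ≡ isRightMin a w) (insertions N w)
  isRightMin-insertions {a} {N} w a<N = front ∷ rest w
    where
    front : isRightMin a (N ∷ w) ≡ isRightMin a w
    front rewrite <⇒<ᵇ≡true a<N = ≡.refl
    rest : ∀ w → All (λ w′ → isRightMin a w′ ≡ isRightMin a w) (later N w)
    rest []      = []
    rest (c ∷ w) = All.map⁺ (All.map (≡.cong ((a <ᵇ c) ∧_)) (isRightMin-insertions w a<N))

  below-later : ∀ a N w → All (λ w′ → below a w′ ≡ below a w) (later N w)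
  below-later a N []      = []
  below-later a N (c ∷ w) = All.map⁺ (All.universal (λ _ → ≡.refl) (insertions N w))

  interior-above : ∀ {a b} w → below a w ≡ false → below b w ≡ false → interior a w ≡ interior b w
  interior-above (c ∷ w) a≮c b≮c rewrite a≮c | b≮c = ≡.refl

  above-letters : ∀ {a N} w → All (_< N) w → below a w ≡ false → below N w ≡ false × isRightMin N w ≡ false
  above-letters (c ∷ w) (c<N ∷ _) _ rewrite <⇒>ᵇ≡false c<N = ≡.refl , ≡.refl

  -- The first letter of `w` lies below both `a` and `N` and is therefore classified alike after
  -- either. `N` is a peak, and the smaller letter to its right keeps it from being a right-to-left
  -- minimum.
  interior-max-after-descent : ∀ {a N} w → a < N → All (_< N) w → below a w ≡ false →
    interior a (N ∷ w) ≡ +peak (interior a w)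
  interior-max-after-descent {a} {N} w a<N w<N a≮w with N≮w , ¬min ← above-letters w w<N a≮w
    rewrite <⇒<ᵇ≡true a<N | N≮w | ¬min = ≡.cong +peak (interior-above w N≮w a≮w)

  interior-max-first : ∀ {a b N} w → a < N → b < N →
    interior b (N ∷ a ∷ w) ≡
    +peak (classify false (below a w) (markRightMin (isRightMin a w) (interior a w)))
  interior-max-first w a<N b<N rewrite <⇒<ᵇ≡true b<N | <⇒>ᵇ≡false a<N = ≡.refl

  -- The transposed insertion operator and its commutation rules.

  module Functionals (R : CommutativeSemiring 0ℓ 0ℓ) where

    open CommutativeSemiring R renaming (Carrier to A)
    open RawSemiringDefs rawSemiring using (_^_) renaming (_×_ to _·_)
    open Multₚ +-commutativeMonoid using (×-congʳ; ×-distrib-+)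
    open SemiringSolver R using (solve; _:+_; _:*_; _:=_)
    open SetoidReasoning setoid

    ∑′ : {B : Set} → List B → (B → A) → A
    ∑′ bs f = foldr _+_ 0# (map f bs)

    ∑-congAll : ∀ {B : Set} {bs : List B} {f g} → All (λ b → f b ≈ g b) bs → ∑′ bs f ≈ ∑′ bs g
    ∑-congAll []         = refl
    ∑-congAll (eq ∷ eqs) = +-cong eq (∑-congAll eqs)

    ∑-cong : ∀ {B : Set} (bs : List B) {f g} → (∀ b → f b ≈ g b) → ∑′ bs f ≈ ∑′ bs g
    ∑-cong bs eq = ∑-congAll (All.universal eq bs)

    ∑-zero : ∀ {B : Set} (bs : List B) → ∑′ bs (λ _ → 0#) ≈ 0#
    ∑-zero []       = refl
    ∑-zero (b ∷ bs) = trans (+-identityˡ _) (∑-zero bs)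

    ∑-map : ∀ {B C : Set} (h : B → C) bs (f : C → A) → ∑′ (map h bs) f ≡ ∑′ bs (f ∘ h)
    ∑-map h []       f = ≡.refl
    ∑-map h (b ∷ bs) f = ≡.cong (f (h b) +_) (∑-map h bs f)

    ∑-++ : ∀ {B : Set} (bs cs : List B) f → ∑′ (bs ++ cs) f ≈ ∑′ bs f + ∑′ cs f
    ∑-++ []       cs f = sym (+-identityˡ _)
    ∑-++ (b ∷ bs) cs f = trans (+-congˡ (∑-++ bs cs f)) (sym (+-assoc _ _ _))

    +-interchange : ∀ a b c d → (a + b) + (c + d) ≈ (a + c) + (b + d)
    +-interchange = solve 4 (λ a b c d → (a :+ b) :+ (c :+ d) := (a :+ c) :+ (b :+ d)) refl

    ∑-+ : ∀ {B : Set} (bs : List B) f g → ∑′ bs (λ b → f b + g b) ≈ ∑′ bs f + ∑′ bs g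
    ∑-+ []       f g = sym (+-identityˡ 0#)
    ∑-+ (b ∷ bs) f g = trans (+-congˡ (∑-+ bs f g)) (+-interchange _ _ _ _)

    ∑-swap : ∀ {B C : Set} (bs : List B) (cs : List C) (f : B → C → A) →
      ∑′ bs (λ b → ∑′ cs (f b)) ≈ ∑′ cs (λ c → ∑′ bs (λ b → f b c))
    ∑-swap []       cs f = sym (∑-zero cs)
    ∑-swap (b ∷ bs) cs f = trans (+-congˡ (∑-swap bs cs f)) (sym (∑-+ cs (f b) _))

    Functional : Set
    Functional = State → A

    infixl 6 _⊕_
    _⊕_ : Functional → Functional → Functional
    (f ⊕ g) s = f s + g s

    infix 4 _≋_
    _≋_ : Functional → Functional → Set
    f ≋ g = ∀ s → f s ≈ g s

    -- L₀ inserts a new maximum after the letter 1: a peak has two gaps charged to it,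
    -- a double ascent or descent one, and the last summand appends at the end. The
    -- junk values of pred have multiplicity 0. L also inserts at the front.
    V C L₀ L : Functional → Functional
    V f s = f (+descent s) + f (+ascent s)
    C f s = f (+prefix s) + f (+ascent (+rightMin s))
    L₀ f s@(state p d a l r) =
      p · V f s + (d · f (state (suc p) (pred d) a l r) +
                   (a · f (state (suc p) d (pred a) l r) + f (+ascent (+rightMin s))))
    L f s = L₀ f s + f (+prefix s)

    suc-pred-· : ∀ n (f : ℕ → A) → n · f (suc (pred n)) ≡ n · f n
    suc-pred-· zero    f = ≡.refl
    suc-pred-· (suc n) f = ≡.refl

    -- This and the next two lemmas are the Leibniz rule for a factor X, Y and P, transposed: the
    -- extra term comes from D X = P, D Y = P and D P = P (X + Y). `suc-pred-·` restores the
    -- exponent lowered by `pred`, which is wrong only where the multiplicity is 0.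
    L₀-+descent : ∀ f s → L₀ f (+descent s) ≈ L₀ (f ∘ +descent) s + f (+peak s)
    L₀-+descent f (state p d a l r)
      rewrite suc-pred-· d (λ d → f (state (suc p) d a l r)) =
      solve 4 (λ x y z w → x :+ ((y :+ z) :+ w) := (x :+ (z :+ w)) :+ y) refl _ _ _ _

    L₀-+ascent : ∀ f s → L₀ f (+ascent s) ≈ L₀ (f ∘ +ascent) s + f (+peak s)
    L₀-+ascent f (state p d a l r)
      rewrite suc-pred-· a (λ a → f (state (suc p) d a l r)) =
      solve 5 (λ x y z w u → x :+ (u :+ ((y :+ z) :+ w)) := (x :+ (u :+ (z :+ w))) :+ y) refl _ _ _ _ _

    L₀-+peak : ∀ f s → L₀ f (+peak s) ≈ L₀ (f ∘ +peak) s + V (f ∘ +peak) s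
    L₀-+peak f s = solve 3 (λ x y z → (x :+ y) :+ z := (y :+ z) :+ x) refl _ _ _

    L₀-cong : ∀ {f g} → f ≋ g → L₀ f ≋ L₀ g
    L₀-cong f≋g (state p d a l r) =
      +-cong (×-congʳ p (+-cong (f≋g _) (f≋g _)))
        (+-cong (×-congʳ d (f≋g _)) (+-cong (×-congʳ a (f≋g _)) (f≋g _)))

    L-⊕ : ∀ f g → L (f ⊕ g) ≋ L f ⊕ L g
    L-⊕ f g s@(state p d a l r) = trans
      (+-congʳ (+-cong (trans (×-congʳ p (+-interchange _ _ _ _)) (×-distrib-+ _ _ p))
        (+-cong (×-distrib-+ _ _ d) (+-congʳ (×-distrib-+ _ _ a)))))
      (solve 10 (λ a₁ a₂ b₁ b₂ c₁ c₂ d₁ d₂ e₁ e₂ →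
           ((a₁ :+ a₂) :+ ((b₁ :+ b₂) :+ ((c₁ :+ c₂) :+ (d₁ :+ d₂)))) :+ (e₁ :+ e₂)
        := ((a₁ :+ (b₁ :+ (c₁ :+ d₁))) :+ e₁) :+ ((a₂ :+ (b₂ :+ (c₂ :+ d₂))) :+ e₂))
        refl _ _ _ _ _ _ _ _ _ _)

    guard : Bool → A → A
    guard b x = if b then x else 0#

    guard-cong : ∀ b {x y} → x ≈ y → guard b x ≈ guard b y
    guard-cong true  x≈y = x≈y
    guard-cong false x≈y = refl

    -- The two guarded terms are the gaps beside the classified letter that are charged to it: the
    -- one after it if its right neighbour is smaller, the one before it if its left neighbour is
    -- smaller. A peak thus has both terms, a double ascent or descent one, a valley none.
    L₀-classify : ∀ f x y r s → L₀ f (classify x y (markRightMin r s)) ≈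
      (L₀ (f ∘ classify x y ∘ markRightMin r) s + guard (not y) (f (classify x true (markRightMin r (+peak s)))))
      + guard x (f (+peak (classify false y (markRightMin r s))))
    L₀-classify f true  true  true  s = trans (L₀-+ascent f (+rightMin s)) (+-congʳ (sym (+-identityʳ _)))
    L₀-classify f true  true  false s = trans (L₀-+ascent f s) (+-congʳ (sym (+-identityʳ _)))
    L₀-classify f true  false true  s = trans (L₀-+peak f (+rightMin s))
      (solve 3 (λ x y z → x :+ (y :+ z) := (x :+ z) :+ y) refl _ _ _)
    L₀-classify f true  false false s = trans (L₀-+peak f s)
      (solve 3 (λ x y z → x :+ (y :+ z) := (x :+ z) :+ y) refl _ _ _)
    L₀-classify f false true  true  s = sym (trans (+-identityʳ _) (+-identityʳ _))
    L₀-classify f false true  false s = sym (trans (+-identityʳ _) (+-identityʳ _))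
    L₀-classify f false false true  s = trans (L₀-+descent f (+rightMin s)) (sym (+-identityʳ _))
    L₀-classify f false false false s = trans (L₀-+descent f s) (sym (+-identityʳ _))

    -- Each gap is charged to the larger of its two neighbours, so the gap before w
    -- counts here only if its left neighbour b is the smaller one.
    ∑-later-interior : ∀ f {b N} w → b < N → All (_< N) w →
      ∑′ (later N w) (f ∘ interior b) + guard (below b w) (f (interior b (N ∷ w))) ≈ L₀ f (interior b w)
    ∑-later-interior f []      b<N [] rewrite <⇒<ᵇ≡true b<N =
      +-congˡ (trans (sym (+-identityˡ _)) (sym (+-identityˡ _)))
    ∑-later-interior f {b} {N} (a ∷ w) b<N (a<N ∷ w<N) = begin
      ∑′ (map (a ∷_) (insertions N w)) (f ∘ interior b) + guard x (f (interior b (N ∷ a ∷ w)))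
        ≡⟨ ≡.cong₂ (λ u t → u + guard x (f t)) (∑-map (a ∷_) (insertions N w) _) (interior-max-first w a<N b<N) ⟩
      (f (interior b (a ∷ N ∷ w)) + ∑′ (later N w) (f ∘ interior b ∘ (a ∷_))) + guard x (f (+peak _))
        ≈⟨ +-congʳ (+-congˡ (∑-congAll (All.zipWith (λ {w′} → unchanged w′) (below-later a N w , All.tail (isRightMin-insertions w a<N))))) ⟩
      (f (interior b (a ∷ N ∷ w)) + ∑′ (later N w) (f′ ∘ interior a)) + guard x (f (+peak _))
        ≈⟨ +-congʳ rearrange ⟩
      (L₀ f′ (interior a w) + guard (not y) (f (classify x true (markRightMin r (+peak (interior a w))))))
        + guard x (f (+peak _))
        ≈⟨ L₀-classify f x y r (interior a w) ⟨
      L₀ f (interior b (a ∷ w)) ∎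
      where
      x = b <ᵇ a
      y = below a w
      r = isRightMin a w
      f′ = f ∘ classify x y ∘ markRightMin r
      unchanged : ∀ w′ → below a w′ ≡ y × isRightMin a w′ ≡ r →
                  f (interior b (a ∷ w′)) ≈ f′ (interior a w′)
      unchanged w′ (eq₁ , eq₂) rewrite eq₁ | eq₂ = refl
      first : f (interior b (a ∷ N ∷ w)) ≡ f (classify x true (markRightMin r (interior a (N ∷ w))))
      first rewrite <⇒<ᵇ≡true a<N = ≡.refl
      rearrange : f (interior b (a ∷ N ∷ w)) + ∑′ (later N w) (f′ ∘ interior a) ≈
        L₀ f′ (interior a w) + guard (not y) (f (classify x true (markRightMin r (+peak (interior a w)))))
      -- If `a` is below the head of `w`, the induction hypothesis already counts the gap between
      -- them. Otherwise its guard is off, and this gap supplies the term charged to `a`.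
      rearrange with below a w in y≡ | ∑-later-interior f′ w a<N w<N
      ... | true  | ih = trans (+-comm _ _) (trans (trans (+-congˡ (reflexive first)) ih) (sym (+-identityʳ _)))
      ... | false | ih = trans (+-comm _ _) (+-cong (trans (sym (+-identityʳ _)) ih)
        (reflexive (≡.trans first (≡.cong (f ∘ classify x true ∘ markRightMin r) (interior-max-after-descent w a<N w<N y≡)))))

    ∑-insertions-interior : ∀ f {N} w → 0 < N → All (0 <_) w → All (_< N) w →
      ∑′ (insertions N w) (f ∘ interior 0) ≈ L₀ f (interior 0 w)
    ∑-insertions-interior f {N} w 0<N 0<w w<N = trans (+-comm _ _)
      (trans (+-congˡ (reflexive (≡.cong (λ b → guard b (f (interior 0 (N ∷ w)))) (≡.sym (below-zero w 0<w)))))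
             (∑-later-interior f w 0<N w<N))

    onPRW : Functional → List ℕ → A
    onPRW f w = guard (prw w) (f (statistics w))

    -- A new maximum placed behind a prefix letter, at any point up to the letter 1, creates an
    -- ascent at a letter other than 1, so only the gaps after 1 survive. Insertion at the very
    -- front is left to `onPRW-front`, where it lengthens the prefix.
    ∑-later-onPRW : ∀ f {N} w → 1 < N → All (0 <_) w → All (_< N) w →
      ∑′ (later N w) (onPRW f) ≈ onPRW (L₀ f) w
    ∑-later-onPRW f []      1<N 0<w w<N = refl
    ∑-later-onPRW f {N} (a ∷ w) 1<N (_ ∷ 0<w) (a<N ∷ w<N)
      rewrite ∑-map (a ∷_) (insertions N w) (onPRW f) with a ≡ᵇ 1
    ... | true  = ∑-insertions-interior f w (ℕ.<-trans ℕ.z<s 1<N) 0<w w<N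
    ... | false rewrite <⇒<ᵇ≡true a<N = trans (+-identityˡ _)
      (trans (∑-congAll (All.map (λ {w′} → unchanged w′) (below-later a N w))) descend)
      where
      y = below a w
      unchanged : ∀ w′ → below a w′ ≡ y → guard (not (below a w′) ∧ prw w′) (f (+prefix (statistics w′))) ≈
                  guard (not y ∧ prw w′) (f (+prefix (statistics w′)))
      unchanged w′ eq rewrite eq = refl
      descend : ∑′ (later N w) (λ w′ → guard (not y ∧ prw w′) (f (+prefix (statistics w′)))) ≈
                guard (not y ∧ prw w) (L₀ f (+prefix (statistics w)))
      descend with below a w
      ... | true  = ∑-zero (later N w)
      ... | false = ∑-later-onPRW (f ∘ +prefix) w 1<N 0<w w<N

    onPRW-front : ∀ f {N} w → 1 < N → All (_< N) w → onPRW f (N ∷ w) ≡ onPRW (f ∘ +prefix) w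
    onPRW-front f {suc (suc N)} []      (ℕ.s≤s (ℕ.s≤s _)) []        = ≡.refl
    onPRW-front f {suc (suc N)} (c ∷ w) (ℕ.s≤s (ℕ.s≤s _)) (c<N ∷ _) rewrite <⇒>ᵇ≡false c<N = ≡.refl

    ∑-insertions-onPRW : ∀ f {N} w → 1 < N → All (0 <_) w → All (_< N) w →
      ∑′ (insertions N w) (onPRW f) ≈ onPRW (L f) w
    ∑-insertions-onPRW f {N} w 1<N 0<w w<N = begin
      onPRW f (N ∷ w) + ∑′ (later N w) (onPRW f)  ≈⟨ +-cong (reflexive (onPRW-front f w 1<N w<N)) (∑-later-onPRW f w 1<N 0<w w<N) ⟩
      onPRW (f ∘ +prefix) w + onPRW (L₀ f) w      ≈⟨ +-comm _ _ ⟩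
      onPRW (L₀ f) w + onPRW (f ∘ +prefix) w      ≈⟨ split (prw w) ⟩
      onPRW (L f) w                               ∎
      where
      split : ∀ b {u t} → guard b u + guard b t ≈ guard b (u + t)
      split true  = refl
      split false = +-identityˡ 0#

    -- The transposes of multiplication by P, v, αc and α.
    data Op : Set where
      𝐩 𝐯 𝐜 𝐫 : Op

    act : Op → Functional → Functional
    act 𝐩 f = f ∘ +peak
    act 𝐯 f = V f
    act 𝐜 f = C f
    act 𝐫 f = f ∘ +rightMin

    apply : List Op → Functional → Functional
    apply []      f = f
    apply (o ∷ O) f = act o (apply O f)

    act-cong : ∀ o {f g} → f ≋ g → act o f ≋ act o g
    act-cong 𝐩 f≋g s = f≋g _
    act-cong 𝐯 f≋g s = +-cong (f≋g _) (f≋g _)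
    act-cong 𝐜 f≋g s = +-cong (f≋g _) (f≋g _)
    act-cong 𝐫 f≋g s = f≋g _

    act-⊕ : ∀ o f g → act o (f ⊕ g) ≋ act o f ⊕ act o g
    act-⊕ 𝐩 f g s = refl
    act-⊕ 𝐯 f g s = +-interchange _ _ _ _
    act-⊕ 𝐜 f g s = +-interchange _ _ _ _
    act-⊕ 𝐫 f g s = refl

    act-∑ : ∀ o {B : Set} (bs : List B) (f : B → Functional) →
      act o (λ s → ∑′ bs (λ b → f b s)) ≋ λ s → ∑′ bs (λ b → act o (f b) s)
    act-∑ 𝐩 []       f s = refl
    act-∑ 𝐯 []       f s = +-identityˡ 0#
    act-∑ 𝐜 []       f s = +-identityˡ 0#
    act-∑ 𝐫 []       f s = refl
    act-∑ o (b ∷ bs) f s = trans (act-⊕ o (f b) _ s) (+-congˡ (act-∑ o bs f s))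

    -- The values D P = Pv, D v = P + P, D (αc) = αP and D α = 0, written as sums of operator words
    -- in front of `O`.
    commutator : Op → List Op → List (List Op)
    commutator 𝐩 O = (𝐯 ∷ 𝐩 ∷ O) ∷ []
    commutator 𝐯 O = (𝐩 ∷ O) ∷ (𝐩 ∷ O) ∷ []
    commutator 𝐜 O = (𝐩 ∷ 𝐫 ∷ O) ∷ []
    commutator 𝐫 O = []

    commutators : List Op → List (List Op)
    commutators []      = []
    commutators (o ∷ O) = commutator o O ++ map (o ∷_) (commutators O)

    act-L : ∀ o O f → act o (L (apply O f)) ≋
      λ s → L (apply (o ∷ O) f) s + ∑′ (commutator o O) (λ O′ → apply O′ f s)
    act-L 𝐩 O f s = trans (+-congʳ (L₀-+peak (apply O f) s))
      (trans (solve 3 (λ x y z → (x :+ y) :+ z := (x :+ z) :+ y) refl _ _ _) (+-congˡ (sym (+-identityʳ _))))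
    act-L 𝐯 O f s = begin
      L g (+descent s) + L g (+ascent s)
        ≈⟨ +-cong (+-congʳ (L₀-+descent g s)) (+-congʳ (L₀-+ascent g s)) ⟩
      (L₀ (g ∘ +descent) s + g (+peak s) + g (+prefix (+descent s))) +
      (L₀ (g ∘ +ascent) s + g (+peak s) + g (+prefix (+ascent s)))
        ≈⟨ solve 5 (λ x₁ y₁ x₂ y₂ z → (x₁ :+ z :+ y₁) :+ (x₂ :+ z :+ y₂) :=
             ((x₁ :+ y₁) :+ (x₂ :+ y₂)) :+ (z :+ z)) refl _ _ _ _ _ ⟩
      (L (g ∘ +descent) s + L (g ∘ +ascent) s) + (g (+peak s) + g (+peak s))
        ≈⟨ +-cong (L-⊕ (g ∘ +descent) (g ∘ +ascent) s) (+-congˡ (+-identityʳ _)) ⟨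
      L (V g) s + (g (+peak s) + (g (+peak s) + 0#)) ∎
      where g = apply O f
    act-L 𝐜 O f s = begin
      L (g ∘ +prefix) s + (L₀ (g ∘ +rightMin) (+ascent s) + g (+prefix (+ascent (+rightMin s))))
        ≈⟨ +-congˡ (+-congʳ (L₀-+ascent (g ∘ +rightMin) s)) ⟩
      L (g ∘ +prefix) s + (L₀ (g ∘ +rightMin ∘ +ascent) s + g (+rightMin (+peak s)) + g (+prefix (+ascent (+rightMin s))))
        ≈⟨ solve 4 (λ x y z w → x :+ (y :+ z :+ w) := (x :+ (y :+ w)) :+ z) refl _ _ _ _ ⟩
      (L (g ∘ +prefix) s + L (g ∘ +ascent ∘ +rightMin) s) + g (+rightMin (+peak s))
        ≈⟨ +-cong (L-⊕ (g ∘ +prefix) (g ∘ +ascent ∘ +rightMin) s) (+-identityʳ _) ⟨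
      L (C g) s + (g (+rightMin (+peak s)) + 0#) ∎
      where g = apply O f
    act-L 𝐫 O f s = sym (+-identityʳ _)

    -- The Leibniz rule for a product of generators: `L` is moved past one operator at a time, and
    -- each passage leaves the corresponding commutators behind.
    apply-L : ∀ O f → apply O (L f) ≋ λ s → L (apply O f) s + ∑′ (commutators O) (λ O′ → apply O′ f s)
    apply-L []      f s = sym (+-identityʳ _)
    apply-L (o ∷ O) f s = begin
      act o (apply O (L f)) s                                      ≈⟨ act-cong o (apply-L O f) s ⟩
      act o (L (apply O f) ⊕ λ s → ∑′ (commutators O) (λ O′ → apply O′ f s)) s
        ≈⟨ act-⊕ o (L (apply O f)) _ s ⟩
      act o (L (apply O f)) s + act o (λ s → ∑′ (commutators O) (λ O′ → apply O′ f s)) s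
        ≈⟨ +-cong (act-L o O f s) (act-∑ o (commutators O) (λ O′ → apply O′ f) s) ⟩
      (L (apply (o ∷ O) f) s + ∑′ (commutator o O) (λ O′ → apply O′ f s)) + ∑′ (commutators O) (λ O′ → apply (o ∷ O′) f s)
        ≈⟨ +-assoc _ _ _ ⟩
      L (apply (o ∷ O) f) s + (∑′ (commutator o O) (λ O′ → apply O′ f s) + ∑′ (commutators O) (λ O′ → apply (o ∷ O′) f s))
        ≡⟨ ≡.cong (λ u → L (apply (o ∷ O) f) s + (∑′ (commutator o O) (λ O′ → apply O′ f s) + u))
             (∑-map (o ∷_) (commutators O) (λ O′ → apply O′ f s)) ⟨
      L (apply (o ∷ O) f) s + (∑′ (commutator o O) (λ O′ → apply O′ f s) + ∑′ (map (o ∷_) (commutators O)) (λ O′ → apply O′ f s))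
        ≈⟨ +-congˡ (∑-++ (commutator o O) _ _) ⟨
      L (apply (o ∷ O) f) s + ∑′ (commutators (o ∷ O)) (λ O′ → apply O′ f s) ∎

    infix 4 _∼_
    -- Evaluating `apply O f` at `∅` pairs f with the product of the generators listed in `O`, so
    -- this is agreement on the subalgebra generated by P, v, αc and α.
    _∼_ : Functional → Functional → Set
    f ∼ g = ∀ O → apply O f ∅ ≈ apply O g ∅

    -- D annihilates the monomial 1: the three multiplicities are 0, and only the insertions at the
    -- two ends remain.
    L-∅ : ∀ f → L f ∅ ≈ C f ∅
    L-∅ f = trans (+-congʳ (trans (+-identityˡ _) (trans (+-identityˡ _) (+-identityˡ _)))) (+-comm _ _)

    -- Stability of the subalgebra. The part D is absorbed by the commutators, and multiplication by
    -- αc is itself the operator `𝐜`, so each summand is an instance of the hypothesis for another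
    -- operator word.
    L-∼ : ∀ {f g} → f ∼ g → L f ∼ L g
    L-∼ {f} {g} f∼g O = begin
      apply O (L f) ∅                                                          ≈⟨ apply-L O f ∅ ⟩
      L (apply O f) ∅ + ∑′ (commutators O) (λ O′ → apply O′ f ∅)
        ≈⟨ +-cong (trans (L-∅ (apply O f)) (trans (f∼g (𝐜 ∷ O)) (sym (L-∅ (apply O g))))) (∑-cong (commutators O) f∼g) ⟩
      L (apply O g) ∅ + ∑′ (commutators O) (λ O′ → apply O′ g ∅)               ≈⟨ apply-L O g ∅ ⟨
      apply O (L g) ∅                                                          ∎

    -- Because of the transposition, the copy of `F` applied to f first belongs to the letter
    -- inserted last.
    iterate : (Functional → Functional) → ℕ → Functional → Functional
    iterate F zero    f = f
    iterate F (suc n) f = iterate F n (F f)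

    iterate-L-∼ : ∀ n {f g} → f ∼ g → iterate L n f ∅ ≈ iterate L n g ∅
    iterate-L-∼ zero    f∼g = f∼g []
    iterate-L-∼ (suc n) f∼g = iterate-L-∼ n (L-∼ f∼g)

    -- `L` exceeds `L₀` only by the term that lengthens the prefix. That term is 0 for f, and it
    -- stays 0 for `L₀ f` because insertions after the letter 1 leave the prefix alone.
    iterate-L₀≈L : ∀ n f → (∀ s → f (+prefix s) ≈ 0#) → iterate L₀ n f ∅ ≈ iterate L n f ∅
    iterate-L₀≈L n f vanishes = go n f f (λ s → refl) vanishes
      where
      L₀-zero : ∀ s → L₀ (λ _ → 0#) s ≈ 0#
      L₀-zero (state p d a l r) =
        trans (+-cong (trans (×-congʳ p (+-identityˡ _)) (·-zero p)) (+-cong (·-zero d) (+-congʳ (·-zero a))))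
              (trans (+-identityˡ _) (trans (+-identityˡ _) (+-identityˡ _)))
        where
        ·-zero : ∀ n → n · 0# ≈ 0#
        ·-zero zero    = refl
        ·-zero (suc n) = trans (+-identityˡ _) (·-zero n)
      -- Two functionals are carried along because `L₀ f` and `L f` agree only pointwise up to `≈`.
      go : ∀ n f g → f ≋ g → (∀ s → f (+prefix s) ≈ 0#) → iterate L₀ n f ∅ ≈ iterate L n g ∅
      go zero    f g f≋g vanishes = f≋g ∅
      go (suc n) f g f≋g vanishes = go n (L₀ f) (L g)
        (λ s → trans (sym (+-identityʳ _)) (+-cong (L₀-cong f≋g s) (trans (sym (vanishes s)) (f≋g _))))
        (λ s → trans (L₀-cong vanishes s) (L₀-zero s))

    -- Weights that depend on X and Y only through X + Y.

    module Weights (α : A) where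

      -- The constant a is specialised to X.
      weight : (ℕ → A) → A → A → Functional
      weight φ X Y (state p d a l r) = φ p * (X ^ d * (Y ^ a * ((α * X) ^ l * α ^ r)))

      -- An arbitrary φ replaces the powers of P, so that a fixed number of peaks can be selected
      -- later; multiplication by P becomes a shift of φ. The other operators multiply by v, αv and
      -- α, because c = v once a = X.
      scale : A → Op → (ℕ → A) → ℕ → A
      scale v 𝐩 φ = φ ∘ suc
      scale v 𝐯 φ = λ k → v * φ k
      scale v 𝐜 φ = λ k → (α * v) * φ k
      scale v 𝐫 φ = λ k → α * φ k

      scales : A → List Op → (ℕ → A) → ℕ → A
      scales v []      φ = φ
      scales v (o ∷ O) φ = scale v o (scales v O φ)

      act-weight : ∀ o φ {v X Y} → X + Y ≈ v → act o (weight φ X Y) ≋ weight (scale v o φ) X Y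
      act-weight 𝐩 φ eq s = refl
      act-weight 𝐯 φ {v} {X} {Y} eq (state p d a l r) = trans
        (solve 6 (λ c x y u t z → c :* (x :* u :* (t :* z)) :+ c :* (u :* (y :* t :* z)) :=
                                ((x :+ y) :* c) :* (u :* (t :* z))) refl (φ p) X Y (X ^ d) (Y ^ a) ((α * X) ^ l * α ^ r))
        (*-congʳ (*-congʳ eq))
      act-weight 𝐜 φ {v} {X} {Y} eq (state p d a l r) = trans
        (solve 8 (λ c x y e u t z w →
             c :* (u :* (t :* (e :* x :* z :* w))) :+ c :* (u :* (y :* t :* (z :* (e :* w))))
          := ((e :* (x :+ y)) :* c) :* (u :* (t :* (z :* w))))
          refl (φ p) X Y α (X ^ d) (Y ^ a) ((α * X) ^ l) (α ^ r))
        (*-congʳ (*-congʳ (*-congˡ eq)))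
      act-weight 𝐫 φ {v} {X} {Y} eq (state p d a l r) =
        solve 6 (λ c e u t z w → c :* (u :* (t :* (z :* (e :* w)))) := (e :* c) :* (u :* (t :* (z :* w))))
          refl (φ p) α (X ^ d) (Y ^ a) ((α * X) ^ l) (α ^ r)

      apply-weight : ∀ O φ {v X Y} → X + Y ≈ v → apply O (weight φ X Y) ≋ weight (scales v O φ) X Y
      apply-weight []      φ eq s = refl
      apply-weight (o ∷ O) φ eq s =
        trans (act-cong o (apply-weight O φ eq) s) (act-weight o (scales _ O φ) eq s)

      -- At `∅` every power of X and Y is 1, and what remains is the value at 0 of `scales v O φ`,
      -- into which only v = X + Y enters.
      weight-∼ : ∀ φ {X Y X′ Y′} → X + Y ≈ X′ + Y′ → weight φ X Y ∼ weight φ X′ Y′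
      weight-∼ φ eq O = trans (apply-weight O φ eq ∅) (sym (apply-weight O φ refl ∅))

-- From permutations to words, and from positions to recursion.

module Words where

  open Defs hiding (_+_; _*_; _≈_; _^_; 0#; ∑; x; y; α)
  open Insertion
  open State
  open import Data.Nat using (_+_; _*_)
  open ≡

  word : ∀ {n} → Permutation′ n → List ℕ
  word σ = tabulate (λ i → suc (toℕ (σ ⟨$⟩ʳ i)))

  toℕ-punchIn-fromℕ : ∀ n (k : Fin n) → toℕ (punchIn (fromℕ n) k) ≡ toℕ k
  toℕ-punchIn-fromℕ (suc n) Fin.zero    = refl
  toℕ-punchIn-fromℕ (suc n) (Fin.suc k) = cong suc (toℕ-punchIn-fromℕ n k)

  -- The two hypotheses are the equations obeyed by `insert`, stated for plain sequences so that the
  -- induction can drop the first letter without remaining among permutations.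
  tabulate-insertions : ∀ {n} N (g : Fin n → ℕ) (F : Fin (suc n) → Fin (suc n) → ℕ) →
    (∀ i → F i i ≡ N) → (∀ i k → F i (punchIn i k) ≡ g k) →
    tabulate (λ i → tabulate (F i)) ≡ insertions N (tabulate g)
  tabulate-insertions {zero}  N g F Fii Fik = cong (λ u → (u ∷ []) ∷ []) (Fii Fin.zero)
  tabulate-insertions {suc n} N g F Fii Fik = cong₂ _∷_
    (cong₂ _∷_ (Fii Fin.zero) (List.tabulate-cong (Fik Fin.zero)))
    (begin
      tabulate (λ i → tabulate (F (Fin.suc i)))
        ≡⟨ List.tabulate-cong (λ i → cong (_∷ tabulate (F (Fin.suc i) ∘ Fin.suc)) (Fik (Fin.suc i) Fin.zero)) ⟩
      tabulate (λ i → g Fin.zero ∷ tabulate (F (Fin.suc i) ∘ Fin.suc))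
        ≡⟨ List.map-tabulate (λ i → tabulate (F (Fin.suc i) ∘ Fin.suc)) (g Fin.zero ∷_) ⟨
      map (g Fin.zero ∷_) (tabulate (λ i → tabulate (F (Fin.suc i) ∘ Fin.suc)))
        ≡⟨ cong (map (g Fin.zero ∷_)) (tabulate-insertions N (g ∘ Fin.suc) (λ i k → F (Fin.suc i) (Fin.suc k))
             (λ i → Fii (Fin.suc i)) (λ i k → Fik (Fin.suc i) (Fin.suc k))) ⟩
      map (g Fin.zero ∷_) (insertions N (tabulate (g ∘ Fin.suc))) ∎)
    where open ≡-Reasoning

  words-insert : ∀ {n} (π : Permutation′ n) →
    map (λ i → word (insert i (fromℕ n) π)) (allFin (suc n)) ≡ insertions (suc n) (word π)
  words-insert {n} π = trans (List.map-tabulate (λ i → i) (λ i → word (insert i (fromℕ n) π)))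
    (tabulate-insertions (suc n) (λ k → suc (toℕ (π ⟨$⟩ʳ k))) (λ i k → suc (toℕ (insert i (fromℕ n) π ⟨$⟩ʳ k)))
      (λ i → cong suc (trans (cong toℕ (insert-at i (fromℕ n) π)) (Fin.toℕ-fromℕ n)))
      (λ i k → cong suc (trans (cong toℕ (insert-punchIn i (fromℕ n) π k)) (toℕ-punchIn-fromℕ n (π ⟨$⟩ʳ k)))))

  word-positive : ∀ {n} (σ : Permutation′ n) → All (0 <_) (word σ)
  word-positive σ = All.tabulate⁺ (λ _ → ℕ.z<s)

  word-bounded : ∀ {n} (σ : Permutation′ n) → All (_< suc n) (word σ)
  word-bounded σ = All.tabulate⁺ (λ i → ℕ.s<s (Fin.toℕ<n (σ ⟨$⟩ʳ i)))

  word-unique : ∀ {n} (σ : Permutation′ n) → Unique (word σ)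
  word-unique σ = Unique.tabulate⁺ λ {i} {j} eq → begin
    i                          ≡⟨ inverseˡ σ ⟨
    σ ⟨$⟩ˡ (σ ⟨$⟩ʳ i)           ≡⟨ cong (σ ⟨$⟩ˡ_) (Fin.toℕ-injective (ℕ.suc-injective eq)) ⟩
    σ ⟨$⟩ˡ (σ ⟨$⟩ʳ j)           ≡⟨ inverseˡ σ ⟩
    j                          ∎
    where open ≡-Reasoning

  1∈word : ∀ {n} (σ : Permutation′ (suc n)) → 1 ∈ word σ
  1∈word σ = subst (_∈ word σ) (cong (suc ∘ toℕ) (inverseʳ σ)) (Membership.∈-tabulate⁺ {f = λ i → suc (toℕ (σ ⟨$⟩ʳ i))} (σ ⟨$⟩ˡ Fin.zero))

  -- The letters of w, preceded at position 0 by b and followed by +∞.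
  at : ℕ ⁺ → List ℕ → ℕ → ℕ ⁺
  at b w       zero    = b
  at b []      (suc i) = ⊤⁺
  at b (a ∷ w) (suc i) = at [ a ] w i

  ‼≡at : ∀ {n} (σ : Permutation′ n) i → σ ‼ i ≡ at ⊤⁺ (word σ) i
  ‼≡at     σ zero    = refl
  ‼≡at {n} σ (suc i) with i ℕ.<? n
  ... | yes i<n = inside _ i i<n
    where
    inside : ∀ {n b} (f : Fin n → ℕ) i (i<n : i < n) → [ f (fromℕ< i<n) ] ≡ at b (tabulate f) (suc i)
    inside {suc n} f zero    i<n = refl
    inside {suc n} f (suc i) i<n = inside (f ∘ Fin.suc) i (ℕ.s<s⁻¹ i<n)
  ... | no  i≮n = outside _ i (ℕ.≮⇒≥ i≮n)
    where
    outside : ∀ {n b} (f : Fin n → ℕ) i → n ≤ i → ⊤⁺ ≡ at b (tabulate f) (suc i)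
    outside {zero}  f i       n≤i = refl
    outside {suc n} f (suc i) n≤i = outside (f ∘ Fin.suc) i (ℕ.s≤s⁻¹ n≤i)

  lt : ℕ ⁺ → ℕ ⁺ → Bool
  lt a b = does (a <⁺? b)

  bit : Bool → ℕ
  bit b = if b then 1 else 0

  tally : (ℕ → Bool) → ℕ → ℕ
  tally h zero    = 0
  tally h (suc n) = bit (h 0) + tally (h ∘ suc) n

  every : (ℕ → Bool) → ℕ → Bool
  every h zero    = true
  every h (suc n) = h 0 ∧ every (h ∘ suc) n

  tally-cong : ∀ {h k} n → (∀ i → h i ≡ k i) → tally h n ≡ tally k n
  tally-cong zero    eq = refl
  tally-cong (suc n) eq = cong₂ (λ b m → bit b + m) (eq 0) (tally-cong n (eq ∘ suc))

  every-cong : ∀ {h k} n → (∀ i → h i ≡ k i) → every h n ≡ every k n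
  every-cong zero    eq = refl
  every-cong (suc n) eq = cong₂ _∧_ (eq 0) (every-cong n (eq ∘ suc))

  count≡tally : ∀ {P : ℕ → Set} (P? : ∀ i → Dec (P i)) f n →
    count P? (applyUpTo f n) ≡ tally (λ i → does (P? (f i))) n
  count≡tally P? f zero    = refl
  count≡tally P? f (suc n) with does (P? (f 0))
  ... | true  = cong suc (count≡tally P? (f ∘ suc) n)
  ... | false = count≡tally P? (f ∘ suc) n

  all?≡every : ∀ {P : ℕ → Set} (P? : ∀ i → Dec (P i)) f n →
    does (all? P? (applyUpTo f n)) ≡ every (λ i → does (P? (f i))) n
  all?≡every P? f zero    = refl
  all?≡every P? f (suc n) = cong (does (P? (f 0)) ∧_) (all?≡every P? (f ∘ suc) n)

  module Sequence (s : ℕ → ℕ ⁺) where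

    descentAt ascentAt doubleAscentAt doubleDescentAt peakAt : ℕ → Bool
    descentAt       i = lt (s (suc i)) (s i)
    ascentAt        i = lt (s i) (s (suc i))
    doubleAscentAt  i = lt (s i) (s (1 + i)) ∧ lt (s (1 + i)) (s (2 + i))
    doubleDescentAt i = lt (s (1 + i)) (s i) ∧ lt (s (2 + i)) (s (1 + i))
    peakAt          i = lt (s i) (s (1 + i)) ∧ lt (s (2 + i)) (s (1 + i))

    -- `M` is the letter that has just been removed from the front of the sequence; it still has to
    -- be compared with the later ones.
    leftMinAt : ℕ ⁺ → ℕ → Bool
    leftMinAt M i = lt (s (1 + i)) M ∧ every (λ j → lt (s (1 + i)) (s (1 + j))) i

    rightMinAt : ℕ → ℕ → Bool
    rightMinAt n i = every (λ j → lt (s (1 + i)) (s (2 + i + j))) (n ∸ suc i)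

    -- The flag `q` tells whether the letters already removed from the front are free of ascents.
    firstAscentAt : Bool → ℕ → Bool
    firstAscentAt q i =
      not (ascentAt i ∧ (q ∧ every (λ j → not (ascentAt j)) i)) ∨ does (≡-dec ℕ._≟_ (s i) [ 1 ])

  open Sequence

  module _ {n} (σ : Permutation′ n) where

    private
      w = word σ
      s = at ⊤⁺ w

      lt-‼ : ∀ i j → lt (σ ‼ i) (σ ‼ j) ≡ lt (s i) (s j)
      lt-‼ i j = cong₂ lt (‼≡at σ i) (‼≡at σ j)

      length-word : n ≡ length w
      length-word = sym (List.length-tabulate _)

    des≡ : des σ ≡ tally (descentAt (s ∘ suc)) (length w ∸ 1)
    des≡ = trans (count≡tally (isDescent? σ) suc (n ∸ 1)) (trans
      (tally-cong (n ∸ 1) (λ i → lt-‼ (2 + i) (1 + i))) (cong (λ m → tally (descentAt (s ∘ suc)) (m ∸ 1)) length-word))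

    asc≡ : asc σ ≡ tally (ascentAt (s ∘ suc)) (length w ∸ 1)
    asc≡ = trans (count≡tally (isAscent? σ) suc (n ∸ 1)) (trans
      (tally-cong (n ∸ 1) (λ i → lt-‼ (1 + i) (2 + i))) (cong (λ m → tally (ascentAt (s ∘ suc)) (m ∸ 1)) length-word))

    peaks≡ : peaks σ ≡ tally (peakAt s) (length w)
    peaks≡ = trans (count≡tally (isPeak? σ) suc n) (trans
      (tally-cong n (λ i → cong₂ _∧_ (lt-‼ i (1 + i)) (lt-‼ (2 + i) (1 + i)))) (cong (tally _) length-word))

    RLmin≡ : RLmin σ ≡ tally (rightMinAt s (length w)) (length w)
    RLmin≡ = trans (count≡tally (isRLmin? σ) suc n) (trans
      (tally-cong n (λ i → trans (all?≡every (λ j → σ ‼ suc i <⁺? σ ‼ j) (2 + i +_) (n ∸ suc i))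
        (every-cong (n ∸ suc i) (λ j → lt-‼ (1 + i) (2 + i + j)))))
      (cong (λ m → tally (rightMinAt s m) m) length-word))

    LRmin≡ : LRmin σ ≡ tally (λ i → every (λ j → lt (s (1 + i)) (s (1 + j))) i) (length w)
    LRmin≡ = trans (count≡tally (isLRmin? σ) suc n) (trans
      (tally-cong n (λ i → trans (all?≡every (λ j → σ ‼ suc i <⁺? σ ‼ j) suc i)
        (every-cong i (λ j → lt-‼ (1 + i) (1 + j)))))
      (cong (tally _) length-word))

    noDoubleAscent≡ : does (noDoubleAscent? σ) ≡ every (not ∘ doubleAscentAt s) (length w)
    noDoubleAscent≡ = trans (all?≡every _ suc n) (trans
      (every-cong n (λ i → cong₂ (λ a b → not (a ∧ b)) (lt-‼ i (1 + i)) (lt-‼ (1 + i) (2 + i))))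
      (cong (every _) length-word))

    noInteriorDoubleDescent≡ : does (noInteriorDoubleDescent? σ) ≡
      every (not ∘ doubleDescentAt (s ∘ suc)) (length w ∸ 1 ∸ 1)
    noInteriorDoubleDescent≡ = trans (all?≡every _ (2 +_) (n ∸ 1 ∸ 1)) (trans
      (every-cong (n ∸ 1 ∸ 1) (λ i → cong₂ (λ a b → not (a ∧ b)) (lt-‼ (2 + i) (1 + i)) (lt-‼ (3 + i) (2 + i))))
      (cong (λ m → every (not ∘ doubleDescentAt (s ∘ suc)) (m ∸ 1 ∸ 1)) length-word))

    isPRW≡ : does (isPRW? σ) ≡ every (firstAscentAt (s ∘ suc) true) (length w ∸ 1)
    isPRW≡ = trans (all?≡every _ suc (n ∸ 1)) (trans
      (every-cong (n ∸ 1) (λ i → cong₂ _∨_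
        (cong not (cong₂ _∧_ (lt-‼ (1 + i) (2 + i))
          (trans (all?≡every _ suc i) (every-cong i (λ j → cong not (lt-‼ (1 + j) (2 + j)))))))
        (cong (λ l → does (≡-dec ℕ._≟_ l [ 1 ])) (‼≡at σ (suc i)))))
      (cong (λ m → every (firstAscentAt (s ∘ suc) true) (m ∸ 1)) length-word))

  -- Statistics of a word behind a left neighbour.

  <ᵇ-flip : ∀ {a c} → a ≢ c → (c <ᵇ a) ≡ not (a <ᵇ c)
  <ᵇ-flip {a} {c} a≢c with ℕ.<-cmp a c
  ... | tri< a<c _ _ rewrite <⇒<ᵇ≡true a<c | <⇒>ᵇ≡false a<c = refl
  ... | tri≈ _ a≡c _ = contradiction a≡c a≢c
  ... | tri> _ _ c<a rewrite <⇒<ᵇ≡true c<a | <⇒>ᵇ≡false c<a = refl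

  lt-head : ∀ a w → lt [ a ] (at [ a ] w 1) ≡ below a w
  lt-head a []      = refl
  lt-head a (c ∷ w) = refl

  head-lt : ∀ {a} w → Unique (a ∷ w) → lt (at [ a ] w 1) [ a ] ≡ not (below a w)
  head-lt []      _                   = refl
  head-lt (c ∷ w) ((a≢c ∷ _) ∷ _) = <ᵇ-flip a≢c

  classify-count : ∀ x y r s → let s′ = classify x y (markRightMin r s) in
    (#peak s′ ≡ bit (x ∧ not y) + #peak s) × (#doubleDescent s′ ≡ bit (not x ∧ not y) + #doubleDescent s) ×
    (#doubleAscent s′ ≡ bit (x ∧ y) + #doubleAscent s) × (#prefix s′ ≡ #prefix s) ×
    (#rightMin s′ ≡ bit r + #rightMin s)
  classify-count true  true  true  s = refl , refl , refl , refl , refl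
  classify-count true  true  false s = refl , refl , refl , refl , refl
  classify-count true  false true  s = refl , refl , refl , refl , refl
  classify-count true  false false s = refl , refl , refl , refl , refl
  classify-count false true  true  s = refl , refl , refl , refl , refl
  classify-count false true  false s = refl , refl , refl , refl , refl
  classify-count false false true  s = refl , refl , refl , refl , refl
  classify-count false false false s = refl , refl , refl , refl , refl

  module _ (b a : ℕ) (w : List ℕ) where

    private
      counts = classify-count (b <ᵇ a) (below a w) (isRightMin a w) (interior a w)

    #peak-∷ : #peak (interior b (a ∷ w)) ≡ bit ((b <ᵇ a) ∧ not (below a w)) + #peak (interior a w)
    #peak-∷ = proj₁ counts

    #doubleDescent-∷ : #doubleDescent (interior b (a ∷ w)) ≡
      bit (not (b <ᵇ a) ∧ not (below a w)) + #doubleDescent (interior a w)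
    #doubleDescent-∷ = proj₁ (proj₂ counts)

    #doubleAscent-∷ : #doubleAscent (interior b (a ∷ w)) ≡
      bit ((b <ᵇ a) ∧ below a w) + #doubleAscent (interior a w)
    #doubleAscent-∷ = proj₁ (proj₂ (proj₂ counts))

    #prefix-∷ : #prefix (interior b (a ∷ w)) ≡ #prefix (interior a w)
    #prefix-∷ = proj₁ (proj₂ (proj₂ (proj₂ counts)))

    #rightMin-∷ : #rightMin (interior b (a ∷ w)) ≡ bit (isRightMin a w) + #rightMin (interior a w)
    #rightMin-∷ = proj₂ (proj₂ (proj₂ (proj₂ counts)))

  #prefix-interior : ∀ b w → #prefix (interior b w) ≡ 0
  #prefix-interior b []      = refl
  #prefix-interior b (a ∷ w) = trans (#prefix-∷ b a w) (#prefix-interior a w)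

  charge : ∀ x y p d → bit (not y) + (p + d) ≡ bit (x ∧ not y) + p + (bit (not x ∧ not y) + d)
  charge true  y     p d = sym (ℕ.+-assoc (bit (not y)) p d)
  charge false true  p d = refl
  charge false false p d = sym (ℕ.+-suc p d)

  -- Each descent is charged to its larger letter, which is a peak, a double descent, or `b` itself.
  descents-interior : ∀ b w → Unique (b ∷ w) → tally (descentAt (at [ b ] w)) (length w) ≡
    bit (not (below b w)) + (#peak (interior b w) + #doubleDescent (interior b w))
  descents-interior b []      _ = refl
  descents-interior b (a ∷ w) (b≢ ∷ u)
    rewrite <ᵇ-flip (All.head b≢) | descents-interior a w u | #peak-∷ b a w | #doubleDescent-∷ b a w =
    cong (bit (not (b <ᵇ a)) +_) (charge (b <ᵇ a) (below a w) (#peak (interior a w)) (#doubleDescent (interior a w)))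

  -- Each ascent is charged to its larger letter, a peak or a double ascent. The tally ends before
  -- the final step up to +∞.
  ascents-interior : ∀ b w → tally (ascentAt (at [ b ] w)) (length w) ≡
    #peak (interior b w) + #doubleAscent (interior b w)
  ascents-interior b []      = refl
  ascents-interior b (a ∷ w)
    rewrite ascents-interior a w | #peak-∷ b a w | #doubleAscent-∷ b a w =
    split (b <ᵇ a) (below a w) (#peak (interior a w)) (#doubleAscent (interior a w))
    where
    split : ∀ x y p e → bit x + (p + e) ≡ bit (x ∧ not y) + p + (bit (x ∧ y) + e)
    split true  true  p e = sym (ℕ.+-suc p e)
    split true  false p e = refl
    split false y     p e = refl

  peaks-interior : ∀ b w → Unique w → tally (peakAt (at [ b ] w)) (length w) ≡ #peak (interior b w)
  peaks-interior b []      _ = refl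
  peaks-interior b (a ∷ w) u@(_ ∷ u′)
    rewrite #peak-∷ b a w | head-lt w u = cong (bit ((b <ᵇ a) ∧ not (below a w)) +_) (peaks-interior a w u′)

  bit-≡ᵇ : ∀ x m → (not x ∧ (m ≡ᵇ 0)) ≡ (bit x + m ≡ᵇ 0)
  bit-≡ᵇ true  m = refl
  bit-≡ᵇ false m = refl

  noDoubleAscent-interior : ∀ b w → every (not ∘ doubleAscentAt (at [ b ] w)) (length w) ≡
    (#doubleAscent (interior b w) ≡ᵇ 0)
  noDoubleAscent-interior b []      = refl
  noDoubleAscent-interior b (a ∷ w)
    rewrite #doubleAscent-∷ b a w | lt-head a w | noDoubleAscent-interior a w = bit-≡ᵇ ((b <ᵇ a) ∧ below a w) (#doubleAscent (interior a w))

  -- The last letter is followed by +∞ and is never a double descent, so stopping one position short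
  -- of the end misses nothing.
  noDoubleDescent-interior : ∀ a w → Unique (a ∷ w) →
    every (not ∘ doubleDescentAt (at [ a ] w)) (length w ∸ 1) ≡ (#doubleDescent (interior a w) ≡ᵇ 0)
  noDoubleDescent-interior a []           _ = refl
  noDoubleDescent-interior a (c ∷ [])     _ with a <ᵇ c
  ... | true  = refl
  ... | false = refl
  noDoubleDescent-interior a (c ∷ c′ ∷ w) (a≢ ∷ u@(c≢ ∷ _)) = begin
    not ((c <ᵇ a) ∧ (c′ <ᵇ c)) ∧ every (not ∘ doubleDescentAt (at [ c ] (c′ ∷ w))) (length w)
      ≡⟨ cong₂ (λ x y → not x ∧ y) (cong₂ _∧_ (<ᵇ-flip (All.head a≢)) (<ᵇ-flip (All.head c≢)))
           (noDoubleDescent-interior c (c′ ∷ w) u) ⟩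
    not (not (a <ᵇ c) ∧ not (c <ᵇ c′)) ∧ (#doubleDescent (interior c (c′ ∷ w)) ≡ᵇ 0)
      ≡⟨ bit-≡ᵇ (not (a <ᵇ c) ∧ not (c <ᵇ c′)) (#doubleDescent (interior c (c′ ∷ w))) ⟩
    (bit (not (a <ᵇ c) ∧ not (c <ᵇ c′)) + #doubleDescent (interior c (c′ ∷ w)) ≡ᵇ 0)
      ≡⟨ cong (_≡ᵇ 0) (#doubleDescent-∷ a c (c′ ∷ w)) ⟨
    (#doubleDescent (interior a (c ∷ c′ ∷ w)) ≡ᵇ 0) ∎
    where open ≡-Reasoning

  every-isRightMin : ∀ b a w → every (λ j → lt [ a ] (at b w (1 + j))) (length w) ≡ isRightMin a w
  every-isRightMin b a []      = refl
  every-isRightMin b a (c ∷ w) = cong ((a <ᵇ c) ∧_) (every-isRightMin [ c ] a w)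

  rightMins-interior : ∀ l b w → tally (rightMinAt (at l w) (length w)) (length w) ≡ #rightMin (interior b w)
  rightMins-interior l b []      = refl
  rightMins-interior l b (a ∷ w) rewrite #rightMin-∷ b a w | every-isRightMin [ a ] a w =
    cong (bit (isRightMin a w) +_) (rightMins-interior [ a ] a w)

  -- Valleys and peaks alternate up to the final +∞. Hence there are as many valleys as peaks, and
  -- one more if the word starts by descending from `b`.
  length-interior : ∀ b w → length w ≡ bit (not (below b w)) +
    (2 * #peak (interior b w) + #doubleDescent (interior b w) + #doubleAscent (interior b w))
  length-interior b []      = refl
  length-interior b (a ∷ w)
    rewrite #peak-∷ b a w | #doubleDescent-∷ b a w | #doubleAscent-∷ b a w =
    trans (cong suc (length-interior a w))
      (split (b <ᵇ a) (below a w) (#peak (interior a w)) (#doubleDescent (interior a w)) (#doubleAscent (interior a w)))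
    where
    split : ∀ x y p d e → suc (bit (not y) + (2 * p + d + e)) ≡
      bit (not x) + (2 * (bit (x ∧ not y) + p) + (bit (not x ∧ not y) + d) + (bit (x ∧ y) + e))
    split true  true  = solve-∀
    split true  false = solve-∀
    split false true  = solve-∀
    split false false = solve-∀

  -- Statistics of PRW words, by induction on the prefix.

  data PRWWord : List ℕ → Set where
    one    : ∀ {w} → All (1 <_) w → Unique (1 ∷ w) → PRWWord (1 ∷ w)
    prefix : ∀ {a c w} → 1 < a → c < a → PRWWord (c ∷ w) → PRWWord (a ∷ c ∷ w)

  positive∧≢1 : ∀ {w} → All (0 <_) w → All (1 ≢_) w → All (1 <_) w
  positive∧≢1 0<w 1≢w = All.zipWith (λ (0<a , 1≢a) → ℕ.≤∧≢⇒< 0<a 1≢a) (0<w , 1≢w)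

  prw⇒PRWWord : ∀ w → All (0 <_) w → Unique w → prw w ≡ true → PRWWord w
  prw⇒PRWWord (a ∷ w) (0<a ∷ 0<w) u@(a≢ ∷ u′) eq with a ℕ.≟ 1
  ... | yes refl = one (positive∧≢1 0<w a≢) u
  ... | no  a≢1  = split w 0<w a≢ u′ (subst (λ b → (if b then true else not (below a w) ∧ prw w) ≡ true) (dec-false (a ℕ.≟ 1) a≢1) eq)
    where
    split : ∀ w → All (0 <_) w → All (a ≢_) w → Unique w → not (below a w) ∧ prw w ≡ true → PRWWord (a ∷ w)
    split (c ∷ w) 0<w (a≢c ∷ _) u′ eq with ℕ.<-cmp a c
    ... | tri< a<c _ _ rewrite <⇒<ᵇ≡true a<c with () ← eq
    ... | tri≈ _ a≡c _ = contradiction a≡c a≢c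
    ... | tri> _ _ c<a rewrite <⇒>ᵇ≡false c<a =
      prefix (ℕ.≤∧≢⇒< 0<a (a≢1 ∘ sym)) c<a (prw⇒PRWWord (c ∷ w) 0<w u′ eq)

  every-true : ∀ {h} n → (∀ i → h i ≡ true) → every h n ≡ true
  every-true zero    eq = refl
  every-true (suc n) eq = cong₂ _∧_ (eq 0) (every-true n (eq ∘ suc))

  firstAscentAt-false : ∀ s i → firstAscentAt s false i ≡ true
  firstAscentAt-false s i rewrite Bool.∧-zeroʳ (ascentAt s i) = refl

  -- Before the letter 1, both sides reject any ascent. At 1 the next letter is larger, so the first
  -- ascent is there, the flag drops to `false` and all later positions become vacuous. The
  -- membership hypothesis excludes decreasing words without 1, on which the two sides differ.
  firstAscents-prw : ∀ a w → 1 ∈ a ∷ w → All (0 <_) w → Unique (a ∷ w) →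
    every (firstAscentAt (at [ a ] w) true) (length w) ≡ prw (a ∷ w)
  firstAscents-prw .1 []      (here refl)  0<w u = refl
  firstAscents-prw a  (c ∷ w) 1∈ (0<c ∷ 0<w) ((a≢c ∷ a≢) ∷ u) with a ℕ.≟ 1 | 1∈
  ... | yes refl | _ rewrite <⇒<ᵇ≡true (ℕ.≤∧≢⇒< 0<c a≢c) = every-true (length w) (firstAscentAt-false (at [ c ] w))
  ... | no a≢1 | here refl  = contradiction refl a≢1
  ... | no a≢1 | there 1∈cw rewrite dec-false (a ℕ.≟ 1) a≢1 with a <ᵇ c
  ...   | true  = refl
  ...   | false = firstAscents-prw c w 1∈cw 0<w u

  interior-0≡1 : ∀ w → All (1 <_) w → interior 0 w ≡ interior 1 w
  interior-0≡1 []      []        = refl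
  interior-0≡1 (c ∷ w) (1<c ∷ _) rewrite <⇒<ᵇ≡true 1<c | <⇒<ᵇ≡true (ℕ.<-trans ℕ.z<s 1<c) = refl

  below-one : ∀ w → All (1 <_) w → below 1 w ≡ true
  below-one []      []        = refl
  below-one (c ∷ w) (1<c ∷ _) = <⇒<ᵇ≡true 1<c

  descents-PRW : ∀ {a w} → PRWWord (a ∷ w) → let s = statistics (a ∷ w) in
    tally (descentAt (at [ a ] w)) (length w) ≡ #peak s + (#doubleDescent s + #prefix s)
  descents-PRW {w = w} (one 1<w u)
    rewrite descents-interior 1 w u | #prefix-interior 0 w | interior-0≡1 w 1<w | below-one w 1<w =
    cong (#peak (interior 1 w) +_) (sym (ℕ.+-identityʳ _))
  -- Matching on 1 < a exposes two successors in `a`, so that the test `a ≡ᵇ 1` in `statistics`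
  -- computes to `false`; the same pattern recurs below.
  descents-PRW {w = c ∷ w} (prefix (ℕ.s≤s (ℕ.s≤s _)) c<a p) rewrite <⇒<ᵇ≡true c<a =
    trans (cong suc (descents-PRW p)) (rearrange (#peak (statistics (c ∷ w))) _ _)
    where
    rearrange : ∀ p d l → suc (p + (d + l)) ≡ p + (d + suc l)
    rearrange = solve-∀

  ascents-PRW : ∀ {a w} → PRWWord (a ∷ w) → let s = statistics (a ∷ w) in
    tally (ascentAt (at [ a ] w)) (length w) ≡ #peak s + #doubleAscent s
  ascents-PRW {w = w} (one 1<w u) rewrite interior-0≡1 w 1<w = ascents-interior 1 w
  ascents-PRW (prefix (ℕ.s≤s (ℕ.s≤s _)) c<a p) rewrite <⇒>ᵇ≡false c<a = ascents-PRW p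

  -- The left neighbour is +∞ at the outset and the preceding prefix letter during the induction;
  -- all that matters is that it is not below `a`, so that neither the prefix letters nor 1 are
  -- peaks.
  peaks-PRW : ∀ {b a w} → lt b [ a ] ≡ false → PRWWord (a ∷ w) →
    tally (peakAt (at b (a ∷ w))) (suc (length w)) ≡ #peak (statistics (a ∷ w))
  peaks-PRW {w = w} b≮a (one 1<w (_ ∷ u)) rewrite b≮a | interior-0≡1 w 1<w = peaks-interior 1 w u
  peaks-PRW {a = a} b≮a (prefix (ℕ.s≤s (ℕ.s≤s _)) c<a p) rewrite b≮a = peaks-PRW {[ a ]} (<⇒>ᵇ≡false c<a) p

  noDoubleAscent-PRW : ∀ {b a w} → lt b [ a ] ≡ false → PRWWord (a ∷ w) →
    every (not ∘ doubleAscentAt (at b (a ∷ w))) (suc (length w)) ≡ (#doubleAscent (statistics (a ∷ w)) ≡ᵇ 0)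
  noDoubleAscent-PRW {w = w} b≮a (one 1<w _) rewrite b≮a | interior-0≡1 w 1<w = noDoubleAscent-interior 1 w
  noDoubleAscent-PRW {a = a} b≮a (prefix (ℕ.s≤s (ℕ.s≤s _)) c<a p) rewrite b≮a = noDoubleAscent-PRW {[ a ]} (<⇒>ᵇ≡false c<a) p

  isRightMin-one : ∀ w → All (1 <_) w → isRightMin 1 w ≡ true
  isRightMin-one w = dec-true (all? (1 ℕ.<?_) w)

  rightMins-PRW : ∀ {b a w} → PRWWord (a ∷ w) →
    tally (rightMinAt (at b (a ∷ w)) (suc (length w))) (suc (length w)) ≡ suc (#rightMin (statistics (a ∷ w)))
  rightMins-PRW {a = a} {w} (one 1<w _) rewrite every-isRightMin [ 1 ] 1 w | isRightMin-one w 1<w =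
    cong suc (rightMins-interior [ 1 ] 0 w)
  rightMins-PRW {a = a} (prefix {w = w} (ℕ.s≤s (ℕ.s≤s _)) c<a p) rewrite <⇒>ᵇ≡false c<a = rightMins-PRW {[ a ]} p

  no-letters-below-one : ∀ b w (h : ℕ → Bool) → All (1 <_) w → tally (λ i → lt (at b w (suc i)) [ 1 ] ∧ h i) (length w) ≡ 0
  no-letters-below-one b []      h []          = refl
  no-letters-below-one b (c ∷ w) h (1<c ∷ 1<w) rewrite <⇒>ᵇ≡false 1<c = no-letters-below-one [ c ] w (h ∘ suc) 1<w

  lt-absorb : ∀ {a c} x r → c < a → lt x [ a ] ∧ (lt x [ c ] ∧ r) ≡ lt x [ c ] ∧ r
  lt-absorb         ⊤⁺    r c<a = refl
  lt-absorb {a} {c} [ k ] r c<a with k ℕ.<? c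
  ... | yes k<c rewrite <⇒<ᵇ≡true k<c | <⇒<ᵇ≡true (ℕ.<-trans k<c c<a) = refl
  ... | no  k≮c rewrite dec-false (k ℕ.<? c) k≮c = Bool.∧-zeroʳ _

  -- The first letter is always a minimum and is left out here. The minima that remain are the other
  -- prefix letters and, if the prefix is nonempty, the letter 1, so their number is again
  -- `#prefix`. By `lt-absorb`, comparing with the smaller of two successive prefix letters
  -- suffices.
  leftMins-PRW : ∀ {a w} → PRWWord (a ∷ w) →
    tally (leftMinAt (at [ a ] w) [ a ]) (length w) ≡ #prefix (statistics (a ∷ w))
  leftMins-PRW {w = w} (one 1<w _) = trans (no-letters-below-one [ 1 ] w _ 1<w) (sym (#prefix-interior 0 w))
  leftMins-PRW (prefix {c = c} {w} (ℕ.s≤s (ℕ.s≤s _)) c<a p) rewrite <⇒<ᵇ≡true c<a =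
    cong suc (trans (tally-cong (length w) (λ i → lt-absorb (at [ c ] w (suc i)) _ c<a)) (leftMins-PRW p))

  length-PRW : ∀ {a w} → PRWWord (a ∷ w) → let s = statistics (a ∷ w) in
    length w ≡ 2 * #peak s + (#doubleDescent s + #prefix s) + #doubleAscent s
  length-PRW {w = w} (one 1<w _)
    rewrite length-interior 1 w | #prefix-interior 0 w | interior-0≡1 w 1<w
          | below-one w 1<w =
    cong (λ d → 2 * #peak (interior 1 w) + d + #doubleAscent (interior 1 w)) (sym (ℕ.+-identityʳ _))
  length-PRW (prefix {c = c} {w} (ℕ.s≤s (ℕ.s≤s _)) c<a p) =
    trans (cong suc (length-PRW p)) (rearrange (#peak s) (#doubleDescent s) (#prefix s) (#doubleAscent s))
    where
    s = statistics (c ∷ w)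
    rearrange : ∀ p d l e → suc (2 * p + (d + l) + e) ≡ 2 * p + (d + suc l) + e
    rearrange = solve-∀

-- Statistics of permutations read off from states.

module PermutationSums where

  open Defs hiding (_+_; _*_; _≈_; _^_; 0#; ∑; x; y; α)
  open Insertion
  open State
  open Words
  open ≡ using (_≡_)

  isPRW≡prw : ∀ {n} (σ : Permutation′ (suc n)) → does (isPRW? σ) ≡ prw (word σ)
  isPRW≡prw σ = ≡.trans (isPRW≡ σ)
    (firstAscents-prw _ _ (1∈word σ) (All.tail (word-positive σ)) (word-unique σ))

  module _ {n} (σ : Permutation′ (suc n)) (isPRW : IsPRW σ) where

    private
      s = statistics (word σ)
      view : PRWWord (word σ)
      view = prw⇒PRWWord (word σ) (word-positive σ) (word-unique σ)
        (≡.trans (≡.sym (isPRW≡prw σ)) (dec-true (isPRW? σ) isPRW))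

    des-PRW : des σ ≡ #peak s ℕ.+ (#doubleDescent s ℕ.+ #prefix s)
    des-PRW = ≡.trans (des≡ σ) (descents-PRW view)

    asc-PRW : asc σ ≡ #peak s ℕ.+ #doubleAscent s
    asc-PRW = ≡.trans (asc≡ σ) (ascents-PRW view)

    peaks-statistics : peaks σ ≡ #peak s
    peaks-statistics = ≡.trans (peaks≡ σ) (peaks-PRW {⊤⁺} ≡.refl view)

    noDoubleAscent-statistics : does (noDoubleAscent? σ) ≡ (#doubleAscent s ≡ᵇ 0)
    noDoubleAscent-statistics = ≡.trans (noDoubleAscent≡ σ) (noDoubleAscent-PRW {⊤⁺} ≡.refl view)

    minWeight-statistics : minWeight σ ≡ #prefix s ℕ.+ #rightMin s
    minWeight-statistics = ≡.trans
      (≡.cong₂ (λ l r → (l ℕ.+ r) ∸ 2)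
        (≡.trans (LRmin≡ σ) (≡.cong suc (leftMins-PRW view)))
        (≡.trans (RLmin≡ σ) (rightMins-PRW {⊤⁺} view)))
      (≡.cong (_∸ 1) (ℕ.+-suc (#prefix s) (#rightMin s)))

    size-PRW : n ≡ 2 ℕ.* #peak s ℕ.+ (#doubleDescent s ℕ.+ #prefix s) ℕ.+ #doubleAscent s
    size-PRW = ≡.trans (≡.sym (List.length-tabulate _)) (length-PRW view)

  module _ {n} (σ : Permutation′ n) where

    private
      s = interior 0 (word σ)

    des-interior : des σ ≡ #peak s ℕ.+ #doubleDescent s
    des-interior = ≡.trans (des≡ σ) (descents-word (word σ) (word-unique σ))
      where
      descents-word : ∀ w → Unique w → tally (Sequence.descentAt (at ⊤⁺ w ∘ suc)) (length w ∸ 1) ≡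
        #peak (interior 0 w) ℕ.+ #doubleDescent (interior 0 w)
      descents-word []      _ = ≡.refl
      descents-word (a ∷ w) u
        rewrite descents-interior a w u | #peak-∷ 0 a w | #doubleDescent-∷ 0 a w =
        charge (0 ℕ.<ᵇ a) (below a w) (#peak (interior a w)) (#doubleDescent (interior a w))

    noInteriorDoubleDescent-interior : does (noInteriorDoubleDescent? σ) ≡ (#doubleDescent s ≡ᵇ 0)
    noInteriorDoubleDescent-interior = ≡.trans (noInteriorDoubleDescent≡ σ)
      (from-word (word σ) (word-positive σ) (word-unique σ))
      where
      from-word : ∀ w → All (0 <_) w → Unique w →
        every (not ∘ Sequence.doubleDescentAt (at ⊤⁺ w ∘ suc)) (length w ∸ 1 ∸ 1) ≡ (#doubleDescent (interior 0 w) ≡ᵇ 0)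
      from-word []      _         _ = ≡.refl
      -- Behind the neighbour 0 the first letter is never a double descent, which matches the
      -- restriction to interior positions.
      from-word (a ∷ w) (0<a ∷ _) u rewrite #doubleDescent-∷ 0 a w | <⇒<ᵇ≡true 0<a = noDoubleDescent-interior a w u

    RLmin-interior : RLmin σ ≡ #rightMin s
    RLmin-interior = ≡.trans (RLmin≡ σ) (rightMins-interior ⊤⁺ 0 (word σ))

  -- Sums over permutations and the gamma expansion.

  module Expansion (R : CommutativeSemiring 0ℓ 0ℓ) (α : CommutativeSemiring.Carrier R) where

    open CommutativeSemiring R renaming (Carrier to A)
    open RawSemiringDefs rawSemiring using (_^_)
    open Expₚ R using (^-homo-*; ^-congˡ; ^-distrib-*)
    open SemiringSolver R using (solve; _:+_; _:*_; _:=_)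
    open SetoidReasoning setoid
    open Functionals R
    open Weights α

    ∑-cartesianProductWith : ∀ {B C D : Set} (h : B → C → D) bs cs (f : D → A) →
      ∑′ (cartesianProductWith h bs cs) f ≈ ∑′ bs (λ b → ∑′ cs (λ c → f (h b c)))
    ∑-cartesianProductWith h []       cs f = refl
    ∑-cartesianProductWith h (b ∷ bs) cs f = trans (∑-++ (map (h b) cs) _ f)
      (+-cong (reflexive (∑-map (h b) cs f)) (∑-cartesianProductWith h bs cs f))

    ∑-filter : ∀ {B : Set} {P : B → Set} (P? : ∀ b → Dec (P b)) bs (f : B → A) →
      ∑′ (filter P? bs) f ≈ ∑′ bs (λ b → guard (does (P? b)) (f b))
    ∑-filter P? []       f = refl
    ∑-filter P? (b ∷ bs) f with does (P? b)
    ... | true  = +-congˡ (∑-filter P? bs f)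
    ... | false = trans (∑-filter P? bs f) (sym (+-identityˡ _))

    ∑-distribˡ : ∀ {B : Set} c (bs : List B) f → c * ∑′ bs f ≈ ∑′ bs (λ b → c * f b)
    ∑-distribˡ c []       f = zeroʳ c
    ∑-distribˡ c (b ∷ bs) f = trans (distribˡ c _ _) (+-congˡ (∑-distribˡ c bs f))

    ∑-𝔖-suc : ∀ n (G : List ℕ → A) →
      ∑′ (𝔖 (suc n)) (G ∘ word) ≈ ∑′ (𝔖 n) (λ π → ∑′ (insertions (suc n) (word π)) G)
    ∑-𝔖-suc n G = begin
      ∑′ (𝔖 (suc n)) (G ∘ word)
        ≈⟨ ∑-cartesianProductWith (λ i → insert i (fromℕ n)) (allFin (suc n)) (𝔖 n) (G ∘ word) ⟩
      ∑′ (allFin (suc n)) (λ i → ∑′ (𝔖 n) (λ π → G (word (insert i (fromℕ n) π))))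
        ≈⟨ ∑-swap (allFin (suc n)) (𝔖 n) _ ⟩
      ∑′ (𝔖 n) (λ π → ∑′ (allFin (suc n)) (λ i → G (word (insert i (fromℕ n) π))))
        ≈⟨ ∑-cong (𝔖 n) (λ π → reflexive (≡.trans
             (≡.sym (∑-map (λ i → word (insert i (fromℕ n) π)) (allFin (suc n)) G))
             (≡.cong (λ ws → ∑′ ws G) (words-insert π)))) ⟩
      ∑′ (𝔖 n) (λ π → ∑′ (insertions (suc n) (word π)) G) ∎

    ∑-𝔖-interior : ∀ n f → ∑′ (𝔖 n) (f ∘ interior 0 ∘ word) ≈ iterate L₀ n f ∅
    ∑-𝔖-interior zero    f = +-identityʳ _
    ∑-𝔖-interior (suc n) f = begin
      ∑′ (𝔖 (suc n)) (f ∘ interior 0 ∘ word)                            ≈⟨ ∑-𝔖-suc n (f ∘ interior 0) ⟩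
      ∑′ (𝔖 n) (λ π → ∑′ (insertions (suc n) (word π)) (f ∘ interior 0))
        ≈⟨ ∑-cong (𝔖 n) (λ π → ∑-insertions-interior f (word π) ℕ.z<s (word-positive π) (word-bounded π)) ⟩
      ∑′ (𝔖 n) (L₀ f ∘ interior 0 ∘ word)                               ≈⟨ ∑-𝔖-interior n (L₀ f) ⟩
      iterate L₀ (suc n) f ∅                                            ∎

    ∑-𝔖-onPRW : ∀ n f → ∑′ (𝔖 (suc n)) (onPRW f ∘ word) ≈ iterate L n f ∅
    -- The only permutation of one letter is the word 1, with state `∅`; the n insertions therefore
    -- begin with the letter 2.
    ∑-𝔖-onPRW zero    f = +-identityʳ _
    ∑-𝔖-onPRW (suc n) f = begin
      ∑′ (𝔖 (suc (suc n))) (onPRW f ∘ word)                             ≈⟨ ∑-𝔖-suc (suc n) (onPRW f) ⟩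
      ∑′ (𝔖 (suc n)) (λ π → ∑′ (insertions (suc (suc n)) (word π)) (onPRW f))
        ≈⟨ ∑-cong (𝔖 (suc n)) (λ π → ∑-insertions-onPRW f (word π) (ℕ.s<s ℕ.z<s) (word-positive π) (word-bounded π)) ⟩
      ∑′ (𝔖 (suc n)) (onPRW (L f) ∘ word)                               ≈⟨ ∑-𝔖-onPRW n (L f) ⟩
      iterate L (suc n) f ∅                                             ∎

    ∑-PRW : ∀ n f → ∑′ (PRW (suc n)) (f ∘ statistics ∘ word) ≈ iterate L n f ∅
    ∑-PRW n f = begin
      ∑′ (PRW (suc n)) (f ∘ statistics ∘ word)
        ≈⟨ ∑-filter isPRW? (𝔖 (suc n)) _ ⟩
      ∑′ (𝔖 (suc n)) (λ σ → guard (does (isPRW? σ)) (f (statistics (word σ))))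
        ≈⟨ ∑-cong (𝔖 (suc n)) (λ σ → reflexive (≡.cong (λ b → guard b (f (statistics (word σ)))) (isPRW≡prw σ))) ⟩
      ∑′ (𝔖 (suc n)) (onPRW f ∘ word)
        ≈⟨ ∑-𝔖-onPRW n f ⟩
      iterate L n f ∅ ∎

    ∑-PRW-cong : ∀ n {f g : Permutation′ (suc n) → A} →
      (∀ σ → IsPRW σ → f σ ≈ g σ) → ∑′ (PRW (suc n)) f ≈ ∑′ (PRW (suc n)) g
    ∑-PRW-cong n eq = ∑-congAll (All.map (λ {σ} → eq σ) (All.all-filter isPRW? (𝔖 (suc n))))

    total : ℕ → (ℕ → A) → A → A → A
    total n φ X Y = ∑′ (PRW (suc n)) (weight φ X Y ∘ statistics ∘ word)

    total-cong : ∀ n φ {X Y X′ Y′} → X + Y ≈ X′ + Y′ → total n φ X Y ≈ total n φ X′ Y′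
    total-cong n φ {X} {Y} {X′} {Y′} eq = trans (∑-PRW n (weight φ X Y))
      (trans (iterate-L-∼ n (weight-∼ φ eq)) (sym (∑-PRW n (weight φ X′ Y′))))

    weight-collect : ∀ φ X Y s → weight φ X Y s ≈
      φ (#peak s) * (X ^ (#doubleDescent s ℕ.+ #prefix s) * (Y ^ #doubleAscent s * α ^ (#prefix s ℕ.+ #rightMin s)))
    weight-collect φ X Y (state p d a l r) = *-congˡ (begin
      X ^ d * (Y ^ a * ((α * X) ^ l * α ^ r))        ≈⟨ *-congˡ (*-congˡ (*-congʳ (^-distrib-* α X l))) ⟩
      X ^ d * (Y ^ a * (α ^ l * X ^ l * α ^ r))
        ≈⟨ solve 5 (λ u t v z w → u :* (t :* (z :* v :* w)) := (u :* v) :* (t :* (z :* w))) refl _ _ _ _ _ ⟩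
      (X ^ d * X ^ l) * (Y ^ a * (α ^ l * α ^ r))    ≈⟨ *-cong (^-homo-* X d l) (*-congˡ (^-homo-* α l r)) ⟨
      X ^ (d ℕ.+ l) * (Y ^ a * α ^ (l ℕ.+ r))        ∎)

    -- Used as φ, it extracts the coefficient of P^k, that is, the words with exactly k peaks.
    δ : ℕ → ℕ → A
    δ k p = guard (p ≡ᵇ k) 1#

    1^ : ∀ n → 1# ^ n ≈ 1#
    1^ zero    = refl
    1^ (suc n) = trans (*-identityˡ _) (1^ n)

    0^ : ∀ n → 0# ^ n ≈ guard (n ≡ᵇ 0) 1#
    0^ zero    = refl
    0^ (suc n) = zeroˡ _

    guard-* : ∀ b {x y} → guard b x * y ≈ guard b (x * y)
    guard-* true  = refl
    guard-* false = zeroˡ _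

    guard-1 : ∀ b {x} → guard b 1# * x ≈ guard b x
    guard-1 b = trans (guard-* b) (guard-cong b (*-identityˡ _))

    guard-∧ : ∀ b c {x} → guard b (guard c x) ≡ guard (b ∧ c) x
    guard-∧ true  c = ≡.refl
    guard-∧ false c = ≡.refl

    γ : ℕ → ℕ → A
    γ n k = ∑′ (Γ⁽¹⁾ n k) (λ σ → α ^ minWeight σ)

    -- Y = 0 removes the words with a double ascent. In the others the ascents are as many as the
    -- peaks, and `size-PRW` forces the exponent of X to be n - 2k. If 2k exceeds n, no word has k
    -- peaks and both sides are 0, so truncation does no harm.
    total-0 : ∀ n k X → total n (δ k) X 0# ≈ X ^ (n ∸ 2 ℕ.* k) * γ n k
    total-0 n k X = begin
      total n (δ k) X 0#
        ≈⟨ ∑-PRW-cong n term ⟩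
      ∑′ (PRW (suc n)) (λ σ → X ^ (n ∸ 2 ℕ.* k) * guard ((asc σ ≡ᵇ k) ∧ does (noDoubleAscent? σ)) (α ^ minWeight σ))
        ≈⟨ ∑-distribˡ _ (PRW (suc n)) _ ⟨
      X ^ (n ∸ 2 ℕ.* k) * ∑′ (PRW (suc n)) (λ σ → guard ((asc σ ≡ᵇ k) ∧ does (noDoubleAscent? σ)) (α ^ minWeight σ))
        ≈⟨ *-congˡ (∑-filter _ (PRW (suc n)) _) ⟨
      X ^ (n ∸ 2 ℕ.* k) * γ n k ∎
      where
      select : ∀ p e a w → n ≡ 2 ℕ.* p ℕ.+ e ℕ.+ a →
        guard (p ≡ᵇ k) (X ^ e * guard (a ≡ᵇ 0) w) ≈ X ^ (n ∸ 2 ℕ.* k) * guard ((p ℕ.+ a ≡ᵇ k) ∧ (a ≡ᵇ 0)) w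
      select p e (suc a) w size rewrite Bool.∧-zeroʳ (p ℕ.+ suc a ≡ᵇ k) =
        trans (trans (guard-cong (p ≡ᵇ k) (zeroʳ _)) (guard-0 (p ≡ᵇ k))) (sym (zeroʳ _))
        where
        guard-0 : ∀ b → guard b 0# ≈ 0#
        guard-0 true  = refl
        guard-0 false = refl
      select p e zero w size = trans restrict (*-congˡ (reflexive (≡.cong (λ b → guard b w) (≡.sym
        (≡.trans (Bool.∧-identityʳ _) (≡.cong (_≡ᵇ k) (ℕ.+-identityʳ p)))))))
        where
        restrict : guard (p ≡ᵇ k) (X ^ e * w) ≈ X ^ (n ∸ 2 ℕ.* k) * guard (p ≡ᵇ k) w
        restrict with p ℕ.≟ k
        ... | no  p≢k rewrite dec-false (p ℕ.≟ k) p≢k = sym (zeroʳ _)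
        ... | yes ≡.refl rewrite dec-true (p ℕ.≟ p) ≡.refl = *-congʳ (reflexive (≡.cong (X ^_) (≡.sym (≡.trans
          (≡.cong (_∸ 2 ℕ.* p) (≡.trans size (ℕ.+-identityʳ _))) (ℕ.m+n∸m≡n (2 ℕ.* p) e)))))
      term : ∀ (σ : Permutation′ (suc n)) → IsPRW σ → weight (δ k) X 0# (statistics (word σ)) ≈
        X ^ (n ∸ 2 ℕ.* k) * guard ((asc σ ≡ᵇ k) ∧ does (noDoubleAscent? σ)) (α ^ minWeight σ)
      term σ isPRW rewrite asc-PRW σ isPRW | noDoubleAscent-statistics σ isPRW | minWeight-statistics σ isPRW =
        trans (weight-collect (δ k) X 0# s)
        (trans (guard-1 (#peak s ≡ᵇ k))
        (trans (guard-cong (#peak s ≡ᵇ k) (*-congˡ (trans (*-congʳ (0^ (#doubleAscent s))) (guard-1 (#doubleAscent s ≡ᵇ 0)))))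
               (select (#peak s) _ (#doubleAscent s) _ (size-PRW σ isPRW))))
        where s = statistics (word σ)

    -- At X = Y = 1 every word with k peaks counts with its power of α alone; trading (1 , 1) for (2
    -- , 0) produces the factor 2^(n - 2k). The inverse of 2 is a parameter since a semiring need
    -- not have one.
    γ-peaks : ∀ n k ½ → ½ * (1# + 1#) ≈ 1# →
      γ n k ≈ ½ ^ (n ∸ 2 ℕ.* k) * ∑′ (Γ⁽²⁾ n k) (λ σ → α ^ minWeight σ)
    γ-peaks n k ½ ½*2≈1 = sym (begin
      ½ ^ m * ∑′ (Γ⁽²⁾ n k) (λ σ → α ^ minWeight σ)
        ≈⟨ *-congˡ (trans (∑-filter (λ σ → peaks σ ℕ.≟ k) (PRW (suc n)) _) (∑-PRW-cong n term)) ⟩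
      ½ ^ m * total n (δ k) 1# 1#             ≈⟨ *-congˡ (total-cong n (δ k) (sym (+-identityʳ _))) ⟩
      ½ ^ m * total n (δ k) (1# + 1#) 0#      ≈⟨ *-congˡ (total-0 n k (1# + 1#)) ⟩
      ½ ^ m * ((1# + 1#) ^ m * γ n k)         ≈⟨ *-assoc _ _ _ ⟨
      (½ ^ m * (1# + 1#) ^ m) * γ n k         ≈⟨ *-congʳ (^-distrib-* ½ (1# + 1#) m) ⟨
      (½ * (1# + 1#)) ^ m * γ n k             ≈⟨ *-congʳ (trans (^-congˡ m ½*2≈1) (1^ m)) ⟩
      1# * γ n k                              ≈⟨ *-identityˡ _ ⟩
      γ n k                                   ∎)
      where
      m = n ∸ 2 ℕ.* k
      term : ∀ (σ : Permutation′ (suc n)) → IsPRW σ → guard (peaks σ ≡ᵇ k) (α ^ minWeight σ) ≈ weight (δ k) 1# 1# (statistics (word σ))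
      term σ isPRW rewrite peaks-statistics σ isPRW | minWeight-statistics σ isPRW = sym
        (trans (weight-collect (δ k) 1# 1# s)
        (trans (guard-1 (#peak s ≡ᵇ k))
               (guard-cong (#peak s ≡ᵇ k) (trans (*-cong (1^ (#doubleDescent s ℕ.+ #prefix s)) (trans (*-congʳ (1^ (#doubleAscent s))) (*-identityˡ _))) (*-identityˡ _)))))
        where s = statistics (word σ)

    -- X = 0 leaves the permutations without interior double descents, whose descents are as many as
    -- their peaks. It also annihilates the factor αX of a prefix letter, so that `L₀`, which
    -- governs arbitrary permutations, may be replaced by `L`.
    γ-descents : ∀ n k → γ n k ≈ ∑′ (Γ⁽³⁾ n k) (λ σ → α ^ RLmin σ)
    γ-descents n k = sym (begin
      ∑′ (Γ⁽³⁾ n k) (λ σ → α ^ RLmin σ)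
        ≈⟨ trans (∑-filter _ (𝔖 n) _) (∑-cong (𝔖 n) term) ⟩
      ∑′ (𝔖 n) (weight (δ k) 0# 1# ∘ interior 0 ∘ word)   ≈⟨ ∑-𝔖-interior n _ ⟩
      iterate L₀ n (weight (δ k) 0# 1#) ∅                 ≈⟨ iterate-L₀≈L n _ vanishes ⟩
      iterate L n (weight (δ k) 0# 1#) ∅                  ≈⟨ ∑-PRW n _ ⟨
      total n (δ k) 0# 1#                                 ≈⟨ total-cong n (δ k) (+-comm 0# 1#) ⟩
      total n (δ k) 1# 0#                                 ≈⟨ total-0 n k 1# ⟩
      1# ^ (n ∸ 2 ℕ.* k) * γ n k                          ≈⟨ trans (*-congʳ (1^ (n ∸ 2 ℕ.* k))) (*-identityˡ _) ⟩
      γ n k                                               ∎)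
      where
      vanishes : ∀ s → weight (δ k) 0# 1# (+prefix s) ≈ 0#
      vanishes (state p d a l r) = solve 6 (λ c u t e z w → c :* (u :* (t :* ((e :* con 0 :* z) :* w))) := con 0) refl
        (δ k p) (0# ^ d) (1# ^ a) α ((α * 0#) ^ l) (α ^ r)
        where open SemiringSolver R using (con)
      select : ∀ p d w → guard ((p ℕ.+ d ≡ᵇ k) ∧ (d ≡ᵇ 0)) w ≈ guard (p ≡ᵇ k) (guard (d ≡ᵇ 0) w)
      select p zero    w rewrite ℕ.+-identityʳ p | Bool.∧-identityʳ (p ≡ᵇ k) = refl
      select p (suc d) w rewrite guard-∧ (p ≡ᵇ k) false {w} | Bool.∧-zeroʳ (p ℕ.+ suc d ≡ᵇ k) | Bool.∧-zeroʳ (p ≡ᵇ k) = refl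
      term : ∀ (σ : Permutation′ n) → guard ((des σ ≡ᵇ k) ∧ does (noInteriorDoubleDescent? σ)) (α ^ RLmin σ) ≈
        weight (δ k) 0# 1# (interior 0 (word σ))
      term σ rewrite des-interior σ | noInteriorDoubleDescent-interior σ | RLmin-interior σ = sym
        (trans (weight-collect (δ k) 0# 1# s)
        (trans (guard-1 (#peak s ≡ᵇ k))
        (trans (guard-cong (#peak s ≡ᵇ k) (trans
          (*-cong (reflexive (≡.cong (0# ^_) (≡.trans (≡.cong (#doubleDescent s ℕ.+_) #prefix≡0) (ℕ.+-identityʳ _))))
            (trans (*-cong (1^ (#doubleAscent s)) (reflexive (≡.cong (λ l → α ^ (l ℕ.+ #rightMin s)) #prefix≡0))) (*-identityˡ _)))
          (trans (*-congʳ (0^ (#doubleDescent s))) (guard-1 (#doubleDescent s ≡ᵇ 0)))))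
          (sym (select (#peak s) (#doubleDescent s) _)))))
        where
        s = interior 0 (word σ)
        #prefix≡0 : #prefix s ≡ 0
        #prefix≡0 = #prefix-interior 0 (word σ)

    ∑-upTo-suc : ∀ n (f : ℕ → A) → ∑′ (applyUpTo suc n) f ≡ ∑′ (upTo n) (f ∘ suc)
    ∑-upTo-suc n f = ≡.trans (≡.cong (λ ks → ∑′ ks f) (≡.sym (List.map-upTo suc n))) (∑-map suc (upTo n) f)

    ∑-δ : ∀ m n (φ : ℕ → A) w → m < n → ∑′ (upTo n) (λ k → φ k * (δ k m * w)) ≈ φ m * w
    ∑-δ zero    (suc n) φ w _ = trans
      (+-cong (*-congˡ (*-identityˡ w)) (trans (reflexive (∑-upTo-suc n _))
        (trans (∑-cong (upTo n) (λ k → trans (*-congˡ (zeroˡ w)) (zeroʳ _))) (∑-zero (upTo n)))))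
      (+-identityʳ _)
    ∑-δ (suc m) (suc n) φ w m<n = trans
      (+-cong (trans (*-congˡ (zeroˡ w)) (zeroʳ _)) (trans (reflexive (∑-upTo-suc n _)) (∑-δ m n (φ ∘ suc) w (ℕ.s<s⁻¹ m<n))))
      (+-identityˡ _)

    -- Every peak accounts for one descent and one ascent, so (xy)^k splits off from the words with
    -- k peaks. The remaining weight is taken at (x , y), which is traded for (x + y , 0).
    gamma-expansion : ∀ n x y →
      ∑′ (PRW (suc n)) (λ σ → x ^ des σ * y ^ asc σ * α ^ minWeight σ) ≈
      ∑′ (upTo (suc ⌊ n /2⌋)) (λ k → γ n k * (x * y) ^ k * (x + y) ^ (n ∸ 2 ℕ.* k))
    gamma-expansion n x y = begin
      ∑′ (PRW (suc n)) (λ σ → x ^ des σ * y ^ asc σ * α ^ minWeight σ)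
        ≈⟨ ∑-PRW-cong n term ⟩
      ∑′ (PRW (suc n)) (λ σ → ∑′ ks (λ k → (x * y) ^ k * weight (δ k) x y (statistics (word σ))))
        ≈⟨ ∑-swap (PRW (suc n)) ks _ ⟩
      ∑′ ks (λ k → ∑′ (PRW (suc n)) (λ σ → (x * y) ^ k * weight (δ k) x y (statistics (word σ))))
        ≈⟨ ∑-cong ks (λ k → sym (∑-distribˡ _ (PRW (suc n)) _)) ⟩
      ∑′ ks (λ k → (x * y) ^ k * total n (δ k) x y)
        ≈⟨ ∑-cong ks (λ k → *-congˡ (trans (total-cong n (δ k) (sym (+-identityʳ _))) (total-0 n k (x + y)))) ⟩
      ∑′ ks (λ k → (x * y) ^ k * ((x + y) ^ (n ∸ 2 ℕ.* k) * γ n k))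
        ≈⟨ ∑-cong ks (λ k → solve 3 (λ a b c → a :* (b :* c) := c :* a :* b) refl _ _ _) ⟩
      ∑′ ks (λ k → γ n k * (x * y) ^ k * (x + y) ^ (n ∸ 2 ℕ.* k)) ∎
      where
      ks = upTo (suc ⌊ n /2⌋)
      -- The number of peaks must lie in the range of summation for `∑-δ` to pick it out.
      peaks-bound : ∀ p e a → n ≡ 2 ℕ.* p ℕ.+ e ℕ.+ a → p < suc ⌊ n /2⌋
      peaks-bound p e a ≡.refl = ℕ.s≤s (ℕ.≤-trans (ℕ.≤-reflexive (≡.trans (ℕ.n≡⌊n+n/2⌋ p)
          (≡.cong (λ m → ⌊ p ℕ.+ m /2⌋) (≡.sym (ℕ.+-identityʳ p)))))
        (ℕ.⌊n/2⌋-mono (ℕ.≤-trans (ℕ.m≤m+n (2 ℕ.* p) e) (ℕ.m≤m+n _ a))))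
      term : ∀ (σ : Permutation′ (suc n)) → IsPRW σ → x ^ des σ * y ^ asc σ * α ^ minWeight σ ≈
        ∑′ ks (λ k → (x * y) ^ k * weight (δ k) x y (statistics (word σ)))
      term σ isPRW rewrite des-PRW σ isPRW | asc-PRW σ isPRW | minWeight-statistics σ isPRW = begin
        x ^ (#peak s ℕ.+ e) * y ^ (#peak s ℕ.+ a) * α ^ m
          ≈⟨ *-congʳ (*-cong (^-homo-* x (#peak s) e) (^-homo-* y (#peak s) a)) ⟩
        (x ^ #peak s * x ^ e) * (y ^ #peak s * y ^ a) * α ^ m
          ≈⟨ solve 5 (λ u t v z w → (u :* t) :* (v :* z) :* w := (u :* v) :* (t :* (z :* w))) refl _ _ _ _ _ ⟩
        (x ^ #peak s * y ^ #peak s) * (x ^ e * (y ^ a * α ^ m))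
          ≈⟨ *-congʳ (^-distrib-* x y (#peak s)) ⟨
        (x * y) ^ #peak s * (x ^ e * (y ^ a * α ^ m))
          ≈⟨ ∑-δ (#peak s) (suc ⌊ n /2⌋) _ _ (peaks-bound (#peak s) e a (size-PRW σ isPRW)) ⟨
        ∑′ ks (λ k → (x * y) ^ k * (δ k (#peak s) * (x ^ e * (y ^ a * α ^ m))))
          ≈⟨ ∑-cong ks (λ k → *-congˡ (weight-collect (δ k) x y s)) ⟨
        ∑′ ks (λ k → (x * y) ^ k * weight (δ k) x y s) ∎
        where
        s = statistics (word σ)
        e = #doubleDescent s ℕ.+ #prefix s
        a = #doubleAscent s
        m = #prefix s ℕ.+ #rightMin s

-- The theorem over ℚ[x,y,α].

open Defs

½*2≈1 : const ½ * (const 1ℚ + const 1ℚ) ≈ const 1ℚ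
½*2≈1 e with Vec.≡-dec ℕ._≟_ (Vec.replicate 3 0) e
... | yes _ = ≡.refl
... | no  _ = ≡.refl

module PolynomialExpansion = PermutationSums.Expansion (PolynomialSemiring.polynomialCommutativeSemiring {3}) α

theorem2p1 : (n : ℕ) → 1 ≤ n →
    Σ[ γ̃ ∈ (ℕ → ℚ[x,y,α]) ]
    (Ã n ≈ ∑ (upTo (suc ⌊ n /2⌋)) λ k → γ̃ k * (x * y) ^ k * (x + y) ^ (n ∸ 2 *ℕ k))
    × ((k : ℕ) → k ≤ ⌊ n /2⌋ →
    (γ̃ k ≈ ∑ (Γ⁽¹⁾ n k) λ σ → α ^ minWeight σ)
    × (γ̃ k ≈ const ½ ^ (n ∸ 2 *ℕ k) * ∑ (Γ⁽²⁾ n k) λ σ → α ^ minWeight σ)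
    × (γ̃ k ≈ ∑ (Γ⁽³⁾ n k) λ σ → α ^ RLmin σ))
theorem2p1 n _ = γ n , gamma-expansion n x y ,
  λ k _ → (λ _ → ≡.refl) , γ-peaks n k (const ½) ½*2≈1 , γ-descents n k
  where open PolynomialExpansion
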